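{- (Beth definability for ITL-NL.) Let $A$ be an ITL-NL formula, $p$ a propositional variable, and $p'$ a fresh propositional variable ($p'\ne p$, $p'\notin\mathrm{Var}(A)$). If $$\models\Box_aA\wedge\Box_a[p'/p]A\supset\Box_a(p\equiv p'),$$ then there exists an ITL-NL formula $C$ such that $\mathrm{Var}(C)\subseteq\mathrm{Var}(A)\setminus\{p\}$ and $$\models\Box_aA\supset\Box_a(p\equiv C).$$
   Context: $V$ is a vocabulary of propositional variables and $\Sigma=\mathcal P(V)$. ITL-NL formulas: $A::=\bot\mid q\mid A\supset A\mid\bigcirc A\mid A;A\mid A^*\mid\Diamond_l A\mid\Diamond_r A$, with $q\in V$; $\neg,\wedge,\vee,\equiv$ are defined as usual; $\mathrm{Var}(A)$ is the set of variables occurring in $A$; $[p'/p]A$ is the result of substituting $p'$ for $p$ in $A$. For $\sigma:\mathbb Z\to\Sigma$ and integers $i\le j$: $\sigma,i,j\not\models\bot$; $\sigma,i,j\models q$ iff $q\in\sigma^i$; $\sigma,i,j\models A\supset B$ iff $\sigma,i,j\not\models A$ or $\sigma,i,j\models B$; $\sigma,i,j\models\bigcirc A$ iff $i<j$ and $\sigma,i+1,j\models A$; $\sigma,i,j\models A;B$ iff $\sigma,i,k\models A$ and $\sigma,k,j\models B$ for some $k\in\{i,\ldots,j\}$; $\sigma,i,j\models A^*$ iff $i=j$ or there are $k_0=i<k_1<\cdots<k_N=j$ with $\sigma,k_{n-1},k_n\models A$ for $n=1,\ldots,N$; $\sigma,i,j\models\Diamond_l A$ iff $\sigma,k,i\models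 A$ for some $k\le i$; $\sigma,i,j\models\Diamond_r A$ iff $\sigma,j,k\models A$ for some $k\ge j$. $\models A$ means $\sigma,i,j\models A$ for all $\sigma:\mathbb Z\to\Sigma$ and all $i\le j$. $\Diamond_a A=\Diamond_r\Diamond_r\Diamond_l\Diamond_lA$ (access to an arbitrary finite interval) and $\Box_aA=\neg\Diamond_a\neg A$ is the universal modality. -}

module Defs where

open import Data.Bool using (if_then_else_)
open import Data.Empty using (⊥)
open import Data.Fin using (Fin; zero; suc; inject₁; fromℕ)
open import Data.Integer using (ℤ; _≤_; _<_) renaming (suc to sucℤ)
open import Data.Nat using (ℕ; suc)
open import Data.Product using (Σ-syntax; ∃-syntax; _×_)
open import Data.Sum using (_⊎_)
open import Level using (0ℓ)
open import Relation.Binary.Definitions using (DecidableEquality)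
open import Relation.Binary.PropositionalEquality using (_≡_)
open import Relation.Nullary using (¬_; does)
open import Relation.Unary using (Pred; _∈_; ∅; ｛_｝; _∪_)

infix  30 _✶
infix  28 ○_ ◇ₗ_ ◇ᵣ_
infixr 26 _⨾_
infixr 22 _⊃_

data Formula (V : Set) : Set where
  ff      : Formula V
  var     : V → Formula V
  _⊃_     : Formula V → Formula V → Formula V
  ○_      : Formula V → Formula V
  _⨾_     : Formula V → Formula V → Formula V
  _✶      : Formula V → Formula V
  ◇ₗ_ ◇ᵣ_ : Formula V → Formula V

module _ {V : Set} where

  infix  28 ~_ ◇ₐ_ □ₐ_
  infixr 24 _∧_
  infix  20 _≣_

  ~_ : Formula V → Formula V
  ~ A = A ⊃ ff

  _∧_ : Formula V → Formula V → Formula V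
  A ∧ B = ~ (A ⊃ ~ B)

  _≣_ : Formula V → Formula V → Formula V
  A ≣ B = (A ⊃ B) ∧ (B ⊃ A)

  ◇ₐ_ : Formula V → Formula V
  ◇ₐ A = ◇ᵣ ◇ᵣ ◇ₗ ◇ₗ A

  □ₐ_ : Formula V → Formula V
  □ₐ A = ~ ◇ₐ ~ A

  Var : Formula V → Pred V 0ℓ
  Var ff      = ∅
  Var (var q) = ｛ q ｝
  Var (A ⊃ B) = Var A ∪ Var B
  Var (○ A)   = Var A
  Var (A ⨾ B) = Var A ∪ Var B
  Var (A ✶)   = Var A
  Var (◇ₗ A)  = Var A
  Var (◇ᵣ A)  = Var A

  -- substitute _≟_ B p A  is  [B/p]A.
  substitute : DecidableEquality V → Formula V → V → Formula V → Formula V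
  substitute _≟_ B p = go
    where
    go : Formula V → Formula V
    go ff      = ff
    go (var q) = if does (q ≟ p) then B else var q
    go (A ⊃ C) = go A ⊃ go C
    go (○ A)   = ○ go A
    go (A ⨾ C) = go A ⨾ go C
    go (A ✶)   = go A ✶
    go (◇ₗ A)  = ◇ₗ go A
    go (◇ᵣ A)  = ◇ᵣ go A

  infix 4 _,_,_⊨_ ⊨_

  -- Meaningful for i ≤ j only; every clause stays within such pairs.
  _,_,_⊨_ : (ℤ → Pred V 0ℓ) → ℤ → ℤ → Formula V → Set
  σ , i , j ⊨ ff      = ⊥
  σ , i , j ⊨ var q   = q ∈ σ i
  σ , i , j ⊨ (A ⊃ B) = ¬ (σ , i , j ⊨ A) ⊎ (σ , i , j ⊨ B)
  σ , i , j ⊨ (○ A)   = i < j × (σ , sucℤ i , j ⊨ A)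
  σ , i , j ⊨ (A ⨾ B) =
    ∃[ k ] i ≤ k × k ≤ j × (σ , i , k ⊨ A) × (σ , k , j ⊨ B)
  σ , i , j ⊨ (A ✶)   =
    i ≡ j ⊎
    (∃[ N ] Σ[ k ∈ (Fin (suc N) → ℤ) ]
      k zero ≡ i × k (fromℕ N) ≡ j ×
      (∀ (n : Fin N) → k (inject₁ n) < k (suc n) ×
                       (σ , k (inject₁ n) , k (suc n) ⊨ A)))
  σ , i , j ⊨ (◇ₗ A)  = ∃[ k ] k ≤ i × (σ , k , i ⊨ A)
  σ , i , j ⊨ (◇ᵣ A)  = ∃[ k ] j ≤ k × (σ , j , k ⊨ A)

  ⊨_ : Formula V → Set₁
  ⊨ A = ∀ (σ : ℤ → Pred V 0ℓ) (i j : ℤ) → i ≤ j → σ , i , j ⊨ A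

-- By Büchi's method, □ₐ A says that some labelling of ℤ is an accepting run of a finite automaton that
-- reads the variables of A other than p and guesses p. Intervals are read by deterministic automata; the
-- labels also record, at each point, the states reachable from the past and the states that accept in
-- the future, which settle ◇ₗ and ◇ᵣ. Implicit definability makes the guess of p unique, so p holds at i
-- exactly when some accepting run guesses p at i, that is, when for some label there are accepting
-- half-runs in both directions from i. Kleene's theorem expresses finite runs by chop and chop-star. The
-- existence of an infinite accepting run is a recurrence property of the finite colouring that maps an
-- interval to its set of possible transitions, as in McNaughton's theorem, so ◇ₗ and ◇ᵣ express it.
module Submission where

open import Defs
open import Axiom.ExcludedMiddle using (ExcludedMiddle)
open import Data.Bool using (Bool; true; false; T; if_then_else_)
open import Data.Bool.Properties using (T?)
open import Data.Empty using (⊥)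
open import Data.Fin using (Fin; zero; suc; inject₁; fromℕ; toℕ)
import Data.Fin as Fin
open import Data.Fin.Properties using (pigeonhole)
open import Data.Integer using (ℤ; +_; -_; ∣_∣; _≤_; _<_; _⊔_; _⊓_; pred) renaming (suc to sucℤ; _+_ to _+ℤ_; _-_ to _-ℤ_)
import Data.Integer.Properties as ℤ
open import Data.List using (List; []; _∷_; map; length; _++_; cartesianProduct)
import Data.List as List
open import Data.List.Membership.Propositional using (lose) renaming (_∈_ to _∈ᴸ_)
open import Data.List.Membership.Propositional.Properties using (∈-map⁺; ∈-++⁺ˡ; ∈-++⁺ʳ; ∈-cartesianProduct⁺; ∈-allFin)
open import Data.List.Relation.Unary.All using (All; []; _∷_)
import Data.List.Relation.Unary.All as All
import Data.List.Relation.Unary.All.Properties as All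
open import Data.List.Relation.Unary.Any using (Any; here; there; index; satisfied)
open import Data.List.Relation.Unary.Any.Properties using (lookup-index)
open import Data.Maybe using (Maybe; just; nothing)
open import Data.Nat using (ℕ; zero; suc)
import Data.Nat as ℕ
import Data.Nat.Properties as ℕ
open import Data.Product using (Σ-syntax; ∃; ∃-syntax; _×_; _,_; proj₁; proj₂)
open import Data.Sum using (_⊎_; inj₁; inj₂; [_,_]′)
import Data.Sum as Sum
open import Data.Unit using (⊤; tt)
open import Data.Vec using (Vec; []; _∷_; lookup; tabulate)
open import Data.Vec.Properties using (lookup∘tabulate; tabulate-cong)
open import Function using (_∘_; id; case_of_)
open import Function.Bundles using (_⇔_; mk⇔; Equivalence)
open import Level using (0ℓ)
open import Relation.Binary.Construct.Closure.ReflexiveTransitive using (Star; ε; _◅_; _◅◅_)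
import Relation.Binary.Construct.Closure.ReflexiveTransitive as Star
open import Relation.Binary.Definitions using (DecidableEquality; tri<; tri≈; tri>)
open import Relation.Binary.PropositionalEquality using (_≡_; _≢_; refl; sym; trans; cong; cong₂; subst; subst₂)
open import Relation.Nullary using (¬_; Dec; yes; no; does; contradiction)
open import Relation.Nullary.Decidable using (does-⇔; decidable-stable)
open import Relation.Unary using (Pred; _∈_; _∉_; _⊆_; _∖_; ｛_｝)
open Equivalence using (to; from)

-- No automaton on infinite words is ever complemented. The half-runs found at different points may
-- come from different guesses of `p`. Each pair closes up to a model of `A` that agrees with the
-- given valuation off `p`, and uniqueness makes all these models agree on `p` as well. Hence no run
-- has to be chosen for all points at once, and a condition on one point suffices. A formula cannot
-- quantify over the infinite set of cut points of a factorisation, and `◇ᵣ` and `◇ₗ` keep only one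
-- end of the interval that they leave. What can be said at a point `k` is that a colour recurs
-- among the intervals from `k`, at points `n` from which some later point is reached with the same
-- colour as from `k`. Since colours multiply, this already yields a factorisation.

module _ (em : ExcludedMiddle 0ℓ) where

  -- Finite types and their subsets.

  record Finite (X : Set) : Set where
    field
      enum     : List X
      complete : ∀ x → x ∈ᴸ enum

  open Finite

  ⊤-finite : Finite ⊤
  ⊤-finite = record { enum = tt ∷ [] ; complete = λ _ → here refl }

  Bool-finite : Finite Bool
  Bool-finite = record
    { enum     = true ∷ false ∷ []
    ; complete = λ { true → here refl ; false → there (here refl) } }

  Maybe-finite : ∀ {X} → Finite X → Finite (Maybe X)
  Maybe-finite F = record
    { enum     = nothing ∷ map just (enum F)
    ; complete = λ { nothing → here refl ; (just x) → there (∈-map⁺ just (complete F x)) } }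

  infixr 2 _×-finite_
  _×-finite_ : ∀ {X Y} → Finite X → Finite Y → Finite (X × Y)
  F ×-finite G = record
    { enum     = cartesianProduct (enum F) (enum G)
    ; complete = λ (x , y) → ∈-cartesianProduct⁺ (complete F x) (complete G y) }

  Vec-finite : ∀ n → Finite (Vec Bool n)
  Vec-finite zero    = record { enum = [] ∷ [] ; complete = λ { [] → here refl } }
  Vec-finite (suc n) = record
    { enum     = map (true ∷_) vs ++ map (false ∷_) vs
    ; complete = λ where
        (true ∷ v)  → ∈-++⁺ˡ (∈-map⁺ (true ∷_) (complete (Vec-finite n) v))
        (false ∷ v) → ∈-++⁺ʳ (map (true ∷_) vs) (∈-map⁺ (false ∷_) (complete (Vec-finite n) v)) }
    where
    vs : List (Vec Bool n)
    vs = enum (Vec-finite n)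

  by-contradiction : ∀ {P : Set} → ¬ ¬ P → P
  by-contradiction = decidable-stable em

  T-does : ∀ {P : Set} (P? : Dec P) → T (does P?) ⇔ P
  T-does (yes p) = mk⇔ (λ _ → p) _
  T-does (no ¬p) = mk⇔ (λ ()) ¬p

  module Subsets {X : Set} (F : Finite X) where

    -- Boolean vectors instead of predicates make the subsets a finite type again, so that they can
    -- serve as states, labels and colours and be compared by propositional equality.
    Sub : Set
    Sub = Vec Bool (length (enum F))

    Sub-finite : Finite Sub
    Sub-finite = Vec-finite _

    infix 4 _∈ₛ_

    abstract

      _∈ₛ_ : X → Sub → Set
      x ∈ₛ u = T (lookup u (index (complete F x)))

      ⟦_⟧ : (X → Set) → Sub
      ⟦ P ⟧ = tabulate (λ a → does (em {P (List.lookup (enum F) a)}))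

      ∈⟦⟧ : ∀ {P : X → Set} {x} → x ∈ₛ ⟦ P ⟧ ⇔ P x
      ∈⟦⟧ {P} {x}
        rewrite lookup∘tabulate (λ a → does (em {P (List.lookup (enum F) a)})) (index (complete F x))
              | sym (lookup-index (complete F x))
        = T-does em

      ⟦⟧-cong : ∀ {P Q : X → Set} → (∀ x → P x ⇔ Q x) → ⟦ P ⟧ ≡ ⟦ Q ⟧
      ⟦⟧-cong P⇔Q = tabulate-cong (λ a → does-⇔ (P⇔Q (List.lookup (enum F) a)) em em)

    -- Distinct vectors may have the same elements, because enum may repeat an element.
    ⟦⟧-≡ : ∀ {P : X → Set} {u} → ⟦ P ⟧ ≡ u ⇔ (⟦ _∈ₛ u ⟧ ≡ u × (∀ x → P x ⇔ x ∈ₛ u))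
    ⟦⟧-≡ {P} = mk⇔
      (λ { refl → ⟦⟧-cong (λ _ → ∈⟦⟧ {P}) , λ _ → mk⇔ (from ∈⟦⟧) (to ∈⟦⟧) })
      (λ (canonical , P⇔) → trans (⟦⟧-cong P⇔) canonical)

  -- The integers, seen in both directions.

  n<suc[n] : ∀ i → i < sucℤ i
  n<suc[n] i = ℤ.suc[i]≤j⇒i<j ℤ.≤-refl

  ≤-offset : ∀ {i j} → i ≤ j → ∃[ n ] j ≡ + n +ℤ i
  ≤-offset {i} {j} i≤j = ∣ j -ℤ i ∣ , sym (trans (cong (_+ℤ i) (ℤ.0≤i⇒+∣i∣≡i (ℤ.i≤j⇒0≤j-i i≤j)))
    (trans (ℤ.+-assoc j (- i) i) (trans (cong (j +ℤ_) (ℤ.+-inverseˡ i)) (ℤ.+-identityʳ j))))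

  ≤-induction : ∀ {i} (P : ℤ → Set) → P i → (∀ {j} → i ≤ j → P j → P (sucℤ j)) → ∀ {j} → i ≤ j → P j
  ≤-induction {i} P base step i≤j with ≤-offset i≤j
  ... | n , refl = go n
    where
    go : ∀ n → P (+ n +ℤ i)
    go zero    = subst P (sym (ℤ.+-identityˡ i)) base
    go (suc n) = subst P (sym (ℤ.suc-+ n i)) (step (ℤ.i≤j+i i (+ n)) (go n))

  -- Ascending induction on the point `k` from which `P k` is carried back to `P i`.
  ≤-induction-down : ∀ {j} (P : ℤ → Set) → P j → (∀ {i} → i < j → P (sucℤ i) → P i) → ∀ {i} → i ≤ j → P i
  ≤-induction-down {j} P base step {i} i≤j = ≤-induction (λ k → k ≤ j → P k → P i) (λ _ → id)
    (λ _ rest k<j → rest (ℤ.≤-trans (ℤ.i≤suc[i] _) k<j) ∘ step (ℤ.suc[i]≤j⇒i<j k<j)) i≤j ℤ.≤-refl base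

  data Side : Set where
    future past : Side

  span : ∀ {ℓ} {A : Set} {C : Set ℓ} → Side → (A → A → C) → A → A → C
  span future R i j = R i j
  span past   R i j = R j i

  span-map : ∀ d {P Q : ℤ → ℤ → Set} {i j} → (∀ {i j} → P i j → Q i j) → span d P i j → span d Q i j
  span-map future f = f
  span-map past   f = f

  infix 4 _≤[_]_ _<[_]_
  _≤[_]_ _<[_]_ : ℤ → Side → ℤ → Set
  i ≤[ d ] j = span d _≤_ i j
  i <[ d ] j = span d _<_ i j

  ≤[]-refl : ∀ d {i} → i ≤[ d ] i
  ≤[]-refl future = ℤ.≤-refl
  ≤[]-refl past   = ℤ.≤-refl

  ≤[]-trans : ∀ d {i j k} → i ≤[ d ] j → j ≤[ d ] k → i ≤[ d ] k
  ≤[]-trans future p q = ℤ.≤-trans p q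
  ≤[]-trans past   p q = ℤ.≤-trans q p

  ≤[]-antisym : ∀ d {i j} → i ≤[ d ] j → j ≤[ d ] i → i ≡ j
  ≤[]-antisym future p q = ℤ.≤-antisym p q
  ≤[]-antisym past   p q = ℤ.≤-antisym q p

  <[]⇒≤[] : ∀ d {i j} → i <[ d ] j → i ≤[ d ] j
  <[]⇒≤[] future = ℤ.<⇒≤
  <[]⇒≤[] past   = ℤ.<⇒≤

  <[]⇒≱[] : ∀ d {i j} → i <[ d ] j → ¬ (j ≤[ d ] i)
  <[]⇒≱[] future = ℤ.<⇒≱
  <[]⇒≱[] past   = ℤ.<⇒≱

  ≰[]⇒>[] : ∀ d {i j} → ¬ (i ≤[ d ] j) → j <[ d ] i
  ≰[]⇒>[] future = ℤ.≰⇒>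
  ≰[]⇒>[] past   = ℤ.≰⇒>

  ≤[]-<[]-trans : ∀ d {i j k} → i ≤[ d ] j → j <[ d ] k → i <[ d ] k
  ≤[]-<[]-trans future p q = ℤ.≤-<-trans p q
  ≤[]-<[]-trans past   p q = ℤ.<-≤-trans q p

  beyond : ∀ d i → ∃[ j ] i <[ d ] j
  beyond future i = sucℤ i , n<suc[n] i
  beyond past   i = pred i , ℤ.≤-<-trans ℤ.≤-refl (ℤ.i≤pred[j]⇒i<j ℤ.≤-refl)

  upper-bound : ∀ d i j → ∃[ k ] i ≤[ d ] k × j ≤[ d ] k
  upper-bound future i j = i ⊔ j , ℤ.i≤i⊔j i j , ℤ.i≤j⊔i i j
  upper-bound past   i j = i ⊓ j , ℤ.i⊓j≤i i j , ℤ.i⊓j≤j i j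

  unbounded : ∀ d (f : ℕ → ℤ) → (∀ a → f a <[ d ] f (suc a)) → ∀ i → ∃[ a ] i ≤[ d ] f a
  unbounded future f f< i with ℤ.≤-total i (f 0)
  ... | inj₁ i≤f0 = 0 , i≤f0
  ... | inj₂ f0≤i = ≤-induction (λ i → ∃[ a ] i ≤ f a) (0 , ℤ.≤-refl)
    (λ _ (a , le) → suc a , ℤ.i<j⇒suc[i]≤j (ℤ.≤-<-trans le (f< a))) f0≤i
  unbounded past f f< i with ℤ.≤-total (f 0) i
  ... | inj₁ f0≤i = 0 , f0≤i
  ... | inj₂ i≤f0 = ≤-induction-down (λ i → ∃[ a ] f a ≤ i) (0 , ℤ.≤-refl)
    (λ _ (a , le) → suc a , subst (f (suc a) ≤_) (ℤ.pred-suc _) (ℤ.i<j⇒i≤pred[j] (ℤ.<-≤-trans (f< a) le))) i≤f0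

  common-bound : ∀ {X} d → Finite X → (P : X → ℤ → Set) →
                 (∀ x → ∃[ K ] (∀ k → K ≤[ d ] k → P x k)) → ∃[ K ] (∀ k → K ≤[ d ] k → ∀ x → P x k)
  common-bound d F P bounds with go (enum F)
    where
    go : ∀ xs → ∃[ K ] (∀ k → K ≤[ d ] k → All (λ x → P x k) xs)
    go []       = + 0 , λ _ _ → []
    go (x ∷ xs) = let K , p = bounds x ; L , q = go xs ; M , K≤M , L≤M = upper-bound d K L in
      M , λ k le → p k (≤[]-trans d K≤M le) ∷ q k (≤[]-trans d L≤M le)
  ... | K , p = K , λ k le x → All.lookup (p k le) (complete F x)

  -- Finite paths along the integers, and chop-star as a chain of intervals.

  data Path {X : Set} (r : ℤ → X → X → Set) : ℤ → X → ℤ → X → Set where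
    []  : ∀ {i x} → Path r i x i x
    _∷_ : ∀ {i x y j z} → r i x y → Path r (sucℤ i) y j z → Path r i x j z

  module _ {X : Set} {r : ℤ → X → X → Set} where

    path-≤ : ∀ {i x j y} → Path r i x j y → i ≤ j
    path-≤ []       = ℤ.≤-refl
    path-≤ (_ ∷ p)  = ℤ.≤-trans (ℤ.i≤suc[i] _) (path-≤ p)

    infixr 5 _++ₚ_
    _++ₚ_ : ∀ {i x j y k z} → Path r i x j y → Path r j y k z → Path r i x k z
    []      ++ₚ q = q
    (s ∷ p) ++ₚ q = s ∷ (p ++ₚ q)

    snoc : ∀ {i x j y z} → Path r i x j y → r j y z → Path r i x (sucℤ j) z
    snoc p s = p ++ₚ (s ∷ [])

    path-split : ∀ {i x j y k} → i ≤ k → k ≤ j → Path r i x j y → ∃[ z ] Path r i x k z × Path r k z j y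
    path-split {i} {k = k} i≤k k≤j p with i ℤ.≟ k
    ... | yes refl = _ , [] , p
    path-split i≤k k≤j []      | no i≢k = contradiction (ℤ.≤-antisym i≤k k≤j) i≢k
    path-split i≤k k≤j (s ∷ p) | no i≢k with path-split (ℤ.i<j⇒suc[i]≤j (ℤ.≤∧≢⇒< i≤k i≢k)) k≤j p
    ... | _ , q , q′ = _ , s ∷ q , q′

    path-preserves : (I : ℤ → X → Set) → (∀ {i x y} → I i x → r i x y → I (sucℤ i) y) →
                     ∀ {i x j y} → Path r i x j y → I i x → I j y
    path-preserves I step []      h = h
    path-preserves I step (s ∷ p) h = path-preserves I step p (step h s)

    path-nil : ∀ {i x j y} → Path r i x j y → i ≡ j → x ≡ y
    path-nil []      _    = refl
    path-nil (_ ∷ p) refl = contradiction (path-≤ p) (ℤ.<⇒≱ (n<suc[n] _))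

    path-unsnoc : ∀ {i x j y} → i ≤ j → Path r i x (sucℤ j) y → ∃[ z ] Path r i x j z × r j z y
    path-unsnoc i≤j p with path-split i≤j (ℤ.i≤suc[i] _) p
    ... | z , q , s = z , q , single s refl
      where
      single : ∀ {i x j y} → Path r i x j y → j ≡ sucℤ i → r i x y
      single []      eq   = contradiction (ℤ.≤-reflexive (sym eq)) (ℤ.<⇒≱ (n<suc[n] _))
      single (s ∷ p) refl = subst (r _ _) (path-nil p refl) s

  Seq : Set → Set₁
  Seq V = ℤ → Pred V 0ℓ

  module _ {V : Set} where

    ✶-Star : ∀ {σ : Seq V} {A i j} →
             (σ , i , j ⊨ (A ✶)) ⇔ Star (λ i j → i < j × (σ , i , j ⊨ A)) i j
    ✶-Star {σ} {A} = mk⇔ (λ { (inj₁ refl) → ε ; (inj₂ (N , k , refl , refl , s)) → chain N k s }) (inj₂ ∘ unchain)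
      where
      R : ℤ → ℤ → Set
      R i j = i < j × (σ , i , j ⊨ A)
      chain : ∀ N (k : Fin (suc N) → ℤ) → (∀ n → R (k (inject₁ n)) (k (suc n))) → Star R (k zero) (k (fromℕ N))
      chain zero    k s = ε
      chain (suc N) k s = s zero ◅ chain N (k ∘ suc) (s ∘ suc)
      unchain : ∀ {i j} → Star R i j →
                ∃[ N ] Σ[ k ∈ (Fin (suc N) → ℤ) ] k zero ≡ i × k (fromℕ N) ≡ j ×
                (∀ (n : Fin N) → R (k (inject₁ n)) (k (suc n)))
      unchain {i} ε = 0 , (λ _ → i) , refl , refl , λ ()
      unchain {i} (r ◅ rs) with unchain rs
      ... | N , k , refl , refl , s = suc N , k′ , refl , refl , s′
        where
        k′ : Fin (suc (suc N)) → ℤ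
        k′ zero    = i
        k′ (suc n) = k n
        s′ : ∀ (n : Fin (suc N)) → R (k′ (inject₁ n)) (k′ (suc n))
        s′ zero    = r
        s′ (suc n) = s n

  Star-< : ∀ {R : ℤ → ℤ → Set} {i j} → Star (λ i j → i < j × R i j) i j → i ≤ j
  Star-< ε              = ℤ.≤-refl
  Star-< ((i<k , _) ◅ s) = ℤ.≤-trans (ℤ.<⇒≤ i<k) (Star-< s)

  -- Definable predicates of intervals, and Kleene's theorem.

  module Definability {V : Set} (X : Pred V 0ℓ) where

    -- Definability is stated semantically, so that a condition can be written as a predicate and
    -- its formula assembled behind it; the two have to agree on genuine intervals only.
    record Def (P : Seq V → ℤ → ℤ → Set) : Set₁ where
      field
        formula : Formula V
        vars    : Var formula ⊆ X
        sem     : ∀ {σ i j} → i ≤ j → (σ , i , j ⊨ formula) ⇔ P σ i j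

    open Def

    private variable P Q : Seq V → ℤ → ℤ → Set

    def-cong : (∀ {σ i j} → i ≤ j → P σ i j ⇔ Q σ i j) → Def P → Def Q
    def-cong P⇔Q d = record
      { formula = formula d
      ; vars    = vars d
      ; sem     = λ i≤j → mk⇔ (to (P⇔Q i≤j) ∘ to (sem d i≤j)) (from (sem d i≤j) ∘ from (P⇔Q i≤j)) }

    def-⇒ : Def P → Def Q → Def (λ σ i j → P σ i j → Q σ i j)
    def-⇒ d e = record
      { formula = formula d ⊃ formula e
      ; vars    = [ vars d , vars e ]′
      ; sem     = λ i≤j → mk⇔
          (λ { (inj₁ ¬p) p → contradiction (from (sem d i≤j) p) ¬p ; (inj₂ q) _ → to (sem e i≤j) q })
          (λ f → case em of λ { (yes p) → inj₂ (from (sem e i≤j) (f (to (sem d i≤j) p))) ; (no ¬p) → inj₁ ¬p }) }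

    def-⊥ : Def (λ _ _ _ → ⊥)
    def-⊥ = record { formula = ff ; vars = λ () ; sem = λ _ → mk⇔ (λ ()) (λ ()) }

    -- Conditions independent of the valuation and the interval, such as the entries of a transition
    -- table, are settled by excluded middle when the formula is built.
    def-const : ∀ C → Def (λ _ _ _ → C)
    def-const C with em {C}
    ... | yes c = def-cong (λ _ → mk⇔ (λ _ → c) (λ _ → id)) (def-⇒ def-⊥ def-⊥)
    ... | no ¬c = def-cong (λ _ → mk⇔ (λ ()) ¬c) def-⊥

    def-¬ : Def P → Def (λ σ i j → ¬ P σ i j)
    def-¬ d = def-⇒ d def-⊥

    def-× : Def P → Def Q → Def (λ σ i j → P σ i j × Q σ i j)
    def-× d e = def-cong
      (λ _ → mk⇔ (λ h → by-contradiction (λ ¬p → h (λ p _ → ¬p p)) , by-contradiction (λ ¬q → h (λ _ → ¬q)))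
                 (λ (p , q) h → h p q))
      (def-¬ (def-⇒ d (def-¬ e)))

    def-⊎ : Def P → Def Q → Def (λ σ i j → P σ i j ⊎ Q σ i j)
    def-⊎ d e = def-cong
      (λ _ → mk⇔ (λ h → case em of λ { (yes p) → inj₁ p ; (no ¬p) → inj₂ (h ¬p) })
                 (λ { (inj₁ p) ¬p → contradiction p ¬p ; (inj₂ q) _ → q }))
      (def-⇒ (def-¬ d) e)

    def-∃ : ∀ {Z} → Finite Z → {P : Z → Seq V → ℤ → ℤ → Set} → (∀ z → Def (P z)) →
            Def (λ σ i j → ∃[ z ] P z σ i j)
    def-∃ F {P} d = def-cong (λ _ → mk⇔ satisfied (λ (z , p) → lose (complete F z) p)) (go (enum F))
      where
      go : ∀ zs → Def (λ σ i j → Any (λ z → P z σ i j) zs)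
      go []       = def-cong (λ _ → mk⇔ (λ ()) (λ ())) def-⊥
      go (z ∷ zs) = def-cong
        (λ _ → mk⇔ [ here , there ]′ (λ { (here p) → inj₁ p ; (there p) → inj₂ p }))
        (def-⊎ (d z) (go zs))

    def-∀ : ∀ {Z} → Finite Z → {P : Z → Seq V → ℤ → ℤ → Set} → (∀ z → Def (P z)) →
            Def (λ σ i j → ∀ z → P z σ i j)
    def-∀ F d = def-cong
      (λ _ → mk⇔ (λ h z → by-contradiction (λ ¬p → h (z , ¬p))) (λ h (z , ¬p) → ¬p (h z)))
      (def-¬ (def-∃ F (def-¬ ∘ d)))

    def-⇔ : Def P → Def Q → Def (λ σ i j → P σ i j ⇔ Q σ i j)
    def-⇔ d e = def-cong (λ _ → mk⇔ (λ (f , g) → mk⇔ f g) (λ h → to h , from h)) (def-× (def-⇒ d e) (def-⇒ e d))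

    def-var : ∀ {v} → v ∈ X → Def (λ σ i j → σ i v)
    def-var {v} v∈X = record { formula = var v ; vars = λ { refl → v∈X } ; sem = λ _ → mk⇔ id id }

    def-○ : Def P → Def (λ σ i j → i < j × P σ (sucℤ i) j)
    def-○ d = record
      { formula = ○ formula d
      ; vars    = vars d
      ; sem     = λ _ → mk⇔ (λ (lt , p) → lt , to (sem d (ℤ.i<j⇒suc[i]≤j lt)) p)
                            (λ (lt , p) → lt , from (sem d (ℤ.i<j⇒suc[i]≤j lt)) p) }

    def-⨾ : Def P → Def Q → Def (λ σ i j → ∃[ k ] i ≤ k × k ≤ j × P σ i k × Q σ k j)
    def-⨾ d e = record
      { formula = formula d ⨾ formula e
      ; vars    = [ vars d , vars e ]′
      ; sem     = λ _ → mk⇔ (λ (k , l , l′ , p , q) → k , l , l′ , to (sem d l) p , to (sem e l′) q)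
                            (λ (k , l , l′ , p , q) → k , l , l′ , from (sem d l) p , from (sem e l′) q) }

    def-✶ : Def P → Def (λ σ i j → Star (λ i j → i < j × P σ i j) i j)
    def-✶ d = record
      { formula = formula d ✶
      ; vars    = vars d
      ; sem     = λ {σ} _ → mk⇔
          (Star.map (λ (lt , p) → lt , to (sem d (ℤ.<⇒≤ lt)) p) ∘ to (✶-Star {σ = σ} {formula d}))
          (from (✶-Star {σ = σ} {formula d}) ∘ Star.map (λ (lt , p) → lt , from (sem d (ℤ.<⇒≤ lt)) p)) }

    def-◇ᵣ : Def P → Def (λ σ i j → ∃[ k ] j ≤ k × P σ j k)
    def-◇ᵣ d = record
      { formula = ◇ᵣ formula d
      ; vars    = vars d
      ; sem     = λ _ → mk⇔ (λ (k , l , p) → k , l , to (sem d l) p) (λ (k , l , p) → k , l , from (sem d l) p) }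

    def-◇ₗ : Def P → Def (λ σ i j → ∃[ k ] k ≤ i × P σ k i)
    def-◇ₗ d = record
      { formula = ◇ₗ formula d
      ; vars    = vars d
      ; sem     = λ _ → mk⇔ (λ (k , l , p) → k , l , to (sem d l) p) (λ (k , l , p) → k , l , from (sem d l) p) }

    def-□ᵣ : Def P → Def (λ σ i j → ∀ k → j ≤ k → P σ j k)
    def-□ᵣ d = def-cong
      (λ _ → mk⇔ (λ h k l → by-contradiction (λ ¬p → h (k , l , ¬p))) (λ h (k , l , ¬p) → ¬p (h k l)))
      (def-¬ (def-◇ᵣ (def-¬ d)))

    def-□ₗ : Def P → Def (λ σ i j → ∀ k → k ≤ i → P σ k i)
    def-□ₗ d = def-cong
      (λ _ → mk⇔ (λ h k l → by-contradiction (λ ¬p → h (k , l , ¬p))) (λ h (k , l , ¬p) → ¬p (h k l)))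
      (def-¬ (def-◇ₗ (def-¬ d)))

    def-< : Def (λ _ i j → i < j)
    def-< = def-cong (λ _ → mk⇔ proj₁ (_, tt)) (def-○ (def-const ⊤))

    def-≡ : Def (λ _ i j → i ≡ j)
    def-≡ = def-cong (λ i≤j → mk⇔ (λ ≮ → by-contradiction (≮ ∘ ℤ.≤∧≢⇒< i≤j))
                                  (λ { refl → ℤ.<-irrefl refl }))
                     (def-¬ def-<)

    def-unit : Def (λ _ i j → j ≡ sucℤ i)
    def-unit = def-cong (λ _ → mk⇔ (sym ∘ proj₂) (λ { refl → n<suc[n] _ , refl })) (def-○ def-≡)

    module _ {S : Set} (F : Finite S) where
      open Subsets F

      def-⟦⟧ : {P : S → Seq V → ℤ → ℤ → Set} → (∀ x → Def (P x)) →
               ∀ u → Def (λ σ i j → ⟦ (λ x → P x σ i j) ⟧ ≡ u)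
      def-⟦⟧ d u = def-cong (λ _ → mk⇔ (from ⟦⟧-≡) (to ⟦⟧-≡))
        (def-× (def-const _) (def-∀ F λ x → def-⇔ (d x) (def-const _)))

    -- Kleene's theorem: states are admitted one by one as interior states of a path.
    module Kleene {S : Set} (F : Finite S) (δ : Pred V 0ℓ → S → S → Set)
                  (def-δ : ∀ x y → Def (λ σ i j → δ (σ i) x y)) where

      Trace : Seq V → ℤ → S → ℤ → S → Set
      Trace σ = Path (λ i → δ (σ i))

      -- Only interior states are confined to `L`; the two ends are free. At least one step is
      -- required, because the factors of chop-star have positive length.
      data Via (σ : Seq V) (L : List S) : ℤ → S → ℤ → S → Set where
        edge   : ∀ {i x y} → δ (σ i) x y → Via σ L i x (sucℤ i) y
        _∷[_]_ : ∀ {i x y j z} → δ (σ i) x y → y ∈ᴸ L → Via σ L (sucℤ i) y j z → Via σ L i x j z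

      Via⇒Trace : ∀ {σ L i x j y} → Via σ L i x j y → Trace σ i x j y
      Via⇒Trace (edge s)       = s ∷ []
      Via⇒Trace (s ∷[ _ ] p)   = s ∷ Via⇒Trace p

      Via-< : ∀ {σ L i x j y} → Via σ L i x j y → i < j
      Via-< (edge _)       = n<suc[n] _
      Via-< (_ ∷[ _ ] p)   = ℤ.<-trans (n<suc[n] _) (Via-< p)

      Loops : Seq V → List S → S → ℤ → ℤ → Set
      Loops σ L z = Star (λ i j → i < j × Via σ L i z j z)

      Through : Seq V → List S → S → ℤ → S → ℤ → S → Set
      Through σ L z i x j y =
        ∃[ k ] i ≤ k × k ≤ j × Via σ L i x k z × (∃[ l ] k ≤ l × l ≤ j × Loops σ L z k l × Via σ L l z j y)

      split-at : ∀ {σ L z i x j y} → Via σ (z ∷ L) i x j y → Via σ L i x j y ⊎ Through σ L z i x j y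
      split-at (edge s) = inj₁ (edge s)
      split-at (s ∷[ here refl ] p) with split-at p
      ... | inj₁ q = inj₂ (_ , ℤ.i≤suc[i] _ , ℤ.<⇒≤ (Via-< p) , edge s , _ , ℤ.≤-refl , ℤ.<⇒≤ (Via-< p) , ε , q)
      ... | inj₂ (_ , l , _ , q , m , _ , l′ , loops , q′) =
        inj₂ (_ , ℤ.i≤suc[i] _ , ℤ.<⇒≤ (Via-< p) , edge s
             , m , ℤ.≤-trans l (Star-< loops) , l′ , (Via-< q , q) ◅ loops , q′)
      split-at (s ∷[ there w∈L ] p) with split-at p
      ... | inj₁ q = inj₁ (s ∷[ w∈L ] q)
      ... | inj₂ (k , l , l′ , q , rest) = inj₂ (k , ℤ.≤-trans (ℤ.i≤suc[i] _) l , l′ , s ∷[ w∈L ] q , rest)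

      weaken : ∀ {σ z L i x j y} → Via σ L i x j y → Via σ (z ∷ L) i x j y
      weaken (edge s)       = edge s
      weaken (s ∷[ w ] p)   = s ∷[ there w ] weaken p

      via-++ : ∀ {σ L z i x j y k} → z ∈ᴸ L → Via σ L i x k z → Via σ L k z j y → Via σ L i x j y
      via-++ z∈L (edge s)       q = s ∷[ z∈L ] q
      via-++ z∈L (s ∷[ w ] p)   q = s ∷[ w ] via-++ z∈L p q

      join-at : ∀ {σ L z i x j y} → Via σ L i x j y ⊎ Through σ L z i x j y → Via σ (z ∷ L) i x j y
      join-at (inj₁ p) = weaken p
      join-at {σ} {L} {z} (inj₂ (_ , _ , _ , p , _ , _ , _ , loops , q)) = via-++ (here refl) (weaken p) (absorb loops q)
        where
        absorb : ∀ {k l j y} → Loops σ L z k l → Via σ L l z j y → Via σ (z ∷ L) k z j y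
        absorb ε              q = weaken q
        absorb ((_ , p) ◅ ps) q = via-++ (here refl) (weaken p) (absorb ps q)

      def-Via : ∀ L x y → Def (λ σ i j → Via σ L i x j y)
      def-Via [] x y = def-cong
        (λ _ → mk⇔ (λ { (refl , s) → edge s }) (λ { (edge s) → refl , s })) (def-× def-unit (def-δ x y))
      def-Via (z ∷ L) x y = def-cong (λ _ → mk⇔ join-at split-at)
        (def-⊎ (def-Via L x y) (def-⨾ (def-Via L x z) (def-⨾ (def-✶ (def-Via L z z)) (def-Via L z y))))

      Trace⇔Via : ∀ {σ i x j y} → Trace σ i x j y ⇔ ((i ≡ j × x ≡ y) ⊎ Via σ (enum F) i x j y)
      Trace⇔Via = mk⇔ forward (λ { (inj₁ (refl , refl)) → [] ; (inj₂ p) → Via⇒Trace p })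
        where
        forward : ∀ {σ i x j y} → Trace σ i x j y → (i ≡ j × x ≡ y) ⊎ Via σ (enum F) i x j y
        forward []      = inj₁ (refl , refl)
        forward (s ∷ p) with forward p
        ... | inj₁ (refl , refl) = inj₂ (edge s)
        ... | inj₂ q             = inj₂ (s ∷[ complete F _ ] q)

      def-Trace : ∀ x y → Def (λ σ i j → Trace σ i x j y)
      def-Trace x y = def-cong (λ _ → mk⇔ (from Trace⇔Via) (to Trace⇔Via))
        (def-⊎ (def-× def-≡ (def-const _)) (def-Via (enum F) x y))

  -- Deterministic automata on labelled intervals.

  data Step {S L : Set} (f : S → L → S) (ν : ℤ → L) (i : ℤ) (s : S) : S → Set where
    next : Step f ν i s (f s (ν (sucℤ i)))

  record DFA (L : Set) : Set₁ where
    no-eta-equality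
    field
      State  : Set
      finite : Finite State
      start  : L → State
      step   : State → L → State
      acc    : State → Set

    Run : (ℤ → L) → ℤ → State → ℤ → State → Set
    Run ν = Path (Step step ν)

    -- The word read on [ i , j ] is ν i , … , ν j, both end points included.
    Accepts : (ℤ → L) → ℤ → ℤ → Set
    Accepts ν i j = ∃[ s ] Run ν i (start (ν i)) j s × acc s

    run-total : ∀ {ν i j} s → i ≤ j → ∃[ t ] Run ν i s j t
    run-total {ν} {i} s = ≤-induction (λ j → ∃[ t ] Run ν i s j t) (s , []) (λ _ (_ , p) → _ , snoc p next)

    run-unique : ∀ {ν i s j t t′} → Run ν i s j t → Run ν i s j t′ → t ≡ t′
    run-unique []         q          = path-nil q refl
    run-unique p@(_ ∷ _)  []         = sym (path-nil p refl)
    run-unique (next ∷ p) (next ∷ q) = run-unique p q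

    accepts⇔ : ∀ {ν i j s} → Run ν i (start (ν i)) j s → Accepts ν i j ⇔ acc s
    accepts⇔ p = mk⇔ (λ (_ , q , a) → subst acc (run-unique q p) a) (λ a → _ , p , a)

    run-cong : ∀ {ν ν′ i s j t} → (∀ k → i ≤ k → k ≤ j → ν k ≡ ν′ k) → Run ν i s j t → Run ν′ i s j t
    run-cong ν≗ []         = []
    run-cong {ν} {ν′} {i} {s} ν≗ (next ∷ p) =
      subst (Step step ν′ i s) (cong (step s) (sym (ν≗ _ (ℤ.i≤suc[i] _) (path-≤ p)))) next
      ∷ run-cong (λ k l → ν≗ k (ℤ.≤-trans (ℤ.i≤suc[i] _) l)) p

  open DFA

  pull : ∀ {L M} → (M → L) → DFA L → DFA M
  pull f D = record
    { State = State D ; finite = finite D ; start = start D ∘ f ; step = λ s l → step D s (f l) ; acc = acc D }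

  module _ {L M : Set} (f : M → L) (D : DFA L) {ν : ℤ → M} where

    pull-run : ∀ {i s j t} → Run (pull f D) ν i s j t → Run D (f ∘ ν) i s j t
    pull-run []         = []
    pull-run (next ∷ r) = next ∷ pull-run r

    run-pull : ∀ {i s j t} → Run D (f ∘ ν) i s j t → Run (pull f D) ν i s j t
    run-pull []         = []
    run-pull (next ∷ r) = next ∷ run-pull r

    pull-accepts : ∀ {i j} → Accepts (pull f D) ν i j ⇔ Accepts D (f ∘ ν) i j
    pull-accepts = mk⇔ (λ (_ , r , a) → _ , pull-run r , a) (λ (_ , r , a) → _ , run-pull r , a)

  -- Closure of the recognisable predicates under the interval connectives.

  module Constructions {L : Set} (L-finite : Finite L) where

    module First (C : L → Set) where

      first : DFA L
      first = record { State = L ; finite = L-finite ; start = id ; step = λ s _ → s ; acc = C }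

      constant : ∀ {ν i j s t} → Run first ν i s j t → s ≡ t
      constant []         = refl
      constant (next ∷ p) = constant p

      first⇔ : ∀ {ν i j} → i ≤ j → Accepts first ν i j ⇔ C (ν i)
      first⇔ i≤j = let _ , p = run-total first _ i≤j in
        mk⇔ (λ a → subst C (sym (constant p)) (to (accepts⇔ first p) a))
            (λ c → from (accepts⇔ first p) (subst C (constant p) c))

    module Last (C : L → Set) where

      last : DFA L
      last = record { State = L ; finite = L-finite ; start = id ; step = λ _ l → l ; acc = C }

      current : ∀ {ν i j t} → Run last ν i (ν i) j t → t ≡ ν j
      current {ν} p = path-preserves (λ j t → t ≡ ν j) (λ { _ next → refl }) p refl

      last⇔ : ∀ {ν i j} → i ≤ j → Accepts last ν i j ⇔ C (ν j)
      last⇔ i≤j = let _ , p = run-total last _ i≤j in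
        mk⇔ (λ a → subst C (current p) (to (accepts⇔ last p) a))
            (λ c → from (accepts⇔ last p) (subst C (sym (current p)) c))

    module Implication (D E : DFA L) where

      -- Each automaton ends in exactly one state, so acceptance may be any Boolean combination of
      -- the two verdicts, negative occurrences included.
      implication : DFA L
      implication = record
        { State  = State D × State E
        ; finite = finite D ×-finite finite E
        ; start  = λ l → start D l , start E l
        ; step   = λ (s , t) l → step D s l , step E t l
        ; acc    = λ (s , t) → acc D s → acc E t }

      left : ∀ {ν i u j v} → Run implication ν i u j v → Run D ν i (proj₁ u) j (proj₁ v)
      left []         = []
      left (next ∷ r) = next ∷ left r

      right : ∀ {ν i u j v} → Run implication ν i u j v → Run E ν i (proj₂ u) j (proj₂ v)
      right []         = []
      right (next ∷ r) = next ∷ right r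

      implication⇔ : ∀ {ν i j} → i ≤ j → Accepts implication ν i j ⇔ (Accepts D ν i j → Accepts E ν i j)
      implication⇔ i≤j = let _ , r = run-total implication _ i≤j in mk⇔
        (λ x d → from (accepts⇔ E (right r)) (to (accepts⇔ implication r) x (to (accepts⇔ D (left r)) d)))
        (λ f → from (accepts⇔ implication r) (to (accepts⇔ E (right r)) ∘ f ∘ from (accepts⇔ D (left r))))

    module Next (D : DFA L) where

      -- `nothing` waits at the first point, whose letter is discarded. It rejects, since `○`
      -- demands a further point.
      next-dfa : DFA L
      next-dfa = record
        { State  = Maybe (State D)
        ; finite = Maybe-finite (finite D)
        ; start  = λ _ → nothing
        ; step   = λ { nothing l → just (start D l) ; (just s) l → just (step D s l) }
        ; acc    = λ { nothing → ⊥ ; (just s) → acc D s } }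

      drop : ∀ {ν i s j t} → Run next-dfa ν i (just s) j (just t) → Run D ν i s j t
      drop []         = []
      drop (next ∷ r) = next ∷ drop r

      lift : ∀ {ν i s j t} → Run D ν i s j t → Run next-dfa ν i (just s) j (just t)
      lift []         = []
      lift (next ∷ r) = next ∷ lift r

      next⇔ : ∀ {ν i j} → Accepts next-dfa ν i j ⇔ (i < j × Accepts D ν (sucℤ i) j)
      next⇔ = mk⇔
        (λ { (just _ , next ∷ r , a) → ℤ.suc[i]≤j⇒i<j (path-≤ r) , _ , drop r , a })
        (λ (_ , _ , r , a) → _ , next ∷ lift r , a)

    module Chop (D E : DFA L) where
      open Subsets (finite E)

      -- The subset holds the states of E on the readings begun at the points where D accepted.
      chop : DFA L
      chop = record
        { State  = State D × Sub
        ; finite = finite D ×-finite Sub-finite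
        ; start  = λ l → start D l , ⟦ (λ t → acc D (start D l) × t ≡ start E l) ⟧
        ; step   = λ (s , u) l → step D s l ,
                     ⟦ (λ t → (∃[ t₀ ] t₀ ∈ₛ u × t ≡ step E t₀ l) ⊎ (acc D (step D s l) × t ≡ start E l)) ⟧
        ; acc    = λ (_ , u) → ∃[ t ] t ∈ₛ u × acc E t }

      left : ∀ {ν i x j y} → Run chop ν i x j y → Run D ν i (proj₁ x) j (proj₁ y)
      left []         = []
      left (next ∷ r) = next ∷ left r

      Sound : (ℤ → L) → ℤ → ℤ → State chop → Set
      Sound ν i j (s , u) = Run D ν i (start D (ν i)) j s ×
        (∀ {t} → t ∈ₛ u → ∃[ k ] Accepts D ν i k × Run E ν k (start E (ν k)) j t)

      sound-start : ∀ {ν} i → Sound ν i i (start chop (ν i))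
      sound-start i = [] , λ t∈ → case to ∈⟦⟧ t∈ of λ { (a , refl) → i , (_ , [] , a) , [] }

      sound-step : ∀ {ν i j x y} → Sound ν i j x → Step (step chop) ν j x y → Sound ν i (sucℤ j) y
      sound-step (r , f) next = snoc r next , λ t∈ → case to ∈⟦⟧ t∈ of λ where
        (inj₁ (_ , t₀∈ , refl)) → let k , a , r′ = f t₀∈ in k , a , snoc r′ next
        (inj₂ (a , refl))       → _ , (_ , snoc r next , a) , []

      chop-sound : ∀ {ν i j} → Accepts chop ν i j → ∃[ k ] i ≤ k × k ≤ j × Accepts D ν i k × Accepts E ν k j
      chop-sound {ν} {i} (_ , r , t , t∈ , a) with proj₂ (path-preserves (Sound ν i) sound-step r (sound-start i)) t∈
      ... | k , d@(_ , r₁ , _) , r₂ = k , path-≤ r₁ , path-≤ r₂ , d , t , r₂ , a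

      -- Wherever the first factor may end, the second is begun at that same point, because the two
      -- factors share the point of the cut.
      Fresh : (ℤ → L) → ℤ → State chop → Set
      Fresh ν j (s , u) = acc D s → start E (ν j) ∈ₛ u

      fresh : ∀ {ν i j y} → Run chop ν i (start chop (ν i)) j y → Fresh ν j y
      fresh {ν} r = path-preserves (Fresh ν) (λ { _ next a → from ∈⟦⟧ (inj₂ (a , refl)) }) r
                      (λ a → from ∈⟦⟧ (a , refl))

      track : ∀ {ν i x j y t t′} → Run chop ν i x j y → t ∈ₛ proj₂ x → Run E ν i t j t′ → t′ ∈ₛ proj₂ y
      track {t = t} r t∈ []          = subst (λ z → t ∈ₛ proj₂ z) (path-nil r refl) t∈
      track [] t∈ e@(_ ∷ _)          = subst (_∈ₛ _) (path-nil e refl) t∈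
      track (next ∷ r) t∈ (next ∷ e) = track r (from ∈⟦⟧ (inj₁ (_ , t∈ , refl))) e

      chop-complete : ∀ {ν i j} → (∃[ k ] i ≤ k × k ≤ j × Accepts D ν i k × Accepts E ν k j) → Accepts chop ν i j
      chop-complete {ν} {i} (k , i≤k , k≤j , d , t , e , a)
        with run-total chop {ν} (start chop (ν i)) (ℤ.≤-trans i≤k k≤j)
      ... | _ , r with path-split i≤k k≤j r
      ... | _ , r₁ , r₂ = _ , r , t , track r₂ (fresh r₁ (to (accepts⇔ D (left r₁)) d)) e , a

      chop⇔ : ∀ {ν i j} → Accepts chop ν i j ⇔ (∃[ k ] i ≤ k × k ≤ j × Accepts D ν i k × Accepts E ν k j)
      chop⇔ = mk⇔ chop-sound chop-complete

    module Iteration (D : DFA L) where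
      open Subsets (finite D)

      advance : Sub → L → Sub
      advance u l = ⟦ (λ t → ∃[ s ] s ∈ₛ u × t ≡ step D s l) ⟧

      Hit : Sub → Set
      Hit u = ∃[ s ] s ∈ₛ u × acc D s

      -- A new reading of D is begun whenever one of the pending readings accepts; testing acceptance
      -- before adding the new reading rules out factors of length zero.
      iteration : DFA L
      iteration = record
        { State  = Sub × Bool
        ; finite = Sub-finite ×-finite Bool-finite
        ; start  = λ l → ⟦ _≡ start D l ⟧ , true
        ; step   = λ (u , _) l → ⟦ (λ t → t ∈ₛ advance u l ⊎ (Hit (advance u l) × t ≡ start D l)) ⟧
                               , does (em {Hit (advance u l)})
        ; acc    = λ (_ , b) → T b }

      Chain : (ℤ → L) → ℤ → ℤ → Set
      Chain ν = Star (λ i j → i < j × Accepts D ν i j)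

      Sound : (ℤ → L) → ℤ → ℤ → State iteration → Set
      Sound ν i j (u , b) = (T b → Chain ν i j) ×
        (∀ {t} → t ∈ₛ u → ∃[ k ] Chain ν i k × Run D ν k (start D (ν k)) j t)

      sound-step : ∀ {ν i j x y} → Sound ν i j x → Step (step iteration) ν j x y → Sound ν i (sucℤ j) y
      sound-step {ν} {i} {j} {u , _} (_ , f) next = hit ∘ to (T-does em) , λ t∈ → case to ∈⟦⟧ t∈ of λ where
          (inj₁ t∈)         → let k , c , r , _ = advanced t∈ in k , c , r
          (inj₂ (h , refl)) → _ , hit h , []
        where
        advanced : ∀ {t} → t ∈ₛ advance u (ν (sucℤ j)) →
                   ∃[ k ] Chain ν i k × Run D ν k (start D (ν k)) (sucℤ j) t × k < sucℤ j
        advanced t∈ with to ∈⟦⟧ t∈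
        ... | _ , s∈ , refl with f s∈
        ... | k , c , r = k , c , snoc r next , ℤ.≤-<-trans (path-≤ r) (n<suc[n] j)
        hit : Hit (advance u (ν (sucℤ j))) → Chain ν i (sucℤ j)
        hit (_ , t∈ , a) with advanced t∈
        ... | k , c , r , lt = c ◅◅ (lt , _ , r , a) ◅ ε

      sound : ∀ {ν i j} → Accepts iteration ν i j → Chain ν i j
      sound {ν} {i} (_ , r , b) = proj₁ (path-preserves (Sound ν i) sound-step r
        ((λ _ → ε) , λ t∈ → case to ∈⟦⟧ t∈ of λ { refl → i , ε , [] })) b

      Fresh : (ℤ → L) → ℤ → State iteration → Set
      Fresh ν j (u , b) = T b × start D (ν j) ∈ₛ u

      -- The reading present at `i` stays pending until `j`, where it accepts after at least one
      -- step; this sets the flag and begins the next reading.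
      track : ∀ {ν i x j y s t} → i < j → Run iteration ν i x j y → s ∈ₛ proj₁ x → Run D ν i s j t → acc D t →
              Fresh ν j y
      track i<j [] _ _ _ = contradiction i<j (ℤ.<-irrefl refl)
      track i<j _ _ [] _ = contradiction i<j (ℤ.<-irrefl refl)
      track {ν} {i} {u , _} {j} _ (next ∷ r) s∈ (next ∷ d) a = go (sucℤ i ℤ.≟ j)
        where
        s′∈ : step D _ (ν (sucℤ i)) ∈ₛ advance u (ν (sucℤ i))
        s′∈ = from ∈⟦⟧ (_ , s∈ , refl)
        go : Dec (sucℤ i ≡ j) → _
        go (no ≢)     = track (ℤ.≤∧≢⇒< (path-≤ d) ≢) r (from ∈⟦⟧ (inj₁ s′∈)) d a
        go (yes refl) = subst (Fresh ν j) (path-nil r refl)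
          (from (T-does em) h , from ∈⟦⟧ (inj₂ (h , refl)))
          where
          h : Hit (advance u (ν j))
          h = _ , s′∈ , subst (acc D) (sym (path-nil d refl)) a

      follow : ∀ {ν i j x} → Chain ν i j → Fresh ν i x → ∃[ y ] Run iteration ν i x j y × acc iteration y
      follow ε (b , _) = _ , [] , b
      follow ((i<k , _ , d , a) ◅ c) (_ , s∈) with run-total iteration _ (ℤ.<⇒≤ i<k)
      ... | _ , r with follow c (track i<k r s∈ d a)
      ... | _ , r′ , b = _ , r ++ₚ r′ , b

      iteration⇔ : ∀ {ν i j} → Accepts iteration ν i j ⇔ Chain ν i j
      iteration⇔ = mk⇔ sound (λ c → follow c (tt , from ∈⟦⟧ refl))

  module Recognition {L : Set} (L-finite : Finite L) where
    open Constructions L-finite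

    -- The counterpart of `Def` for labelled words: an automaton is known by the predicate that it
    -- decides, and its states need not be looked at again.
    record Rec (P : (ℤ → L) → ℤ → ℤ → Set) : Set₁ where
      no-eta-equality
      field
        dfa     : DFA L
        accepts : ∀ {ν i j} → i ≤ j → Accepts dfa ν i j ⇔ P ν i j

    open Rec public

    private variable P Q : (ℤ → L) → ℤ → ℤ → Set

    abstract

      rec-cong : (∀ {ν i j} → i ≤ j → P ν i j ⇔ Q ν i j) → Rec P → Rec Q
      rec-cong P⇔Q r = record
        { dfa     = dfa r
        ; accepts = λ i≤j → mk⇔ (to (P⇔Q i≤j) ∘ to (accepts r i≤j)) (from (accepts r i≤j) ∘ from (P⇔Q i≤j)) }

      rec-dfa : (D : DFA L) → Rec (Accepts D)
      rec-dfa D = record { dfa = D ; accepts = λ _ → mk⇔ id id }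

      rec-start : (C : L → Set) → Rec (λ ν i _ → C (ν i))
      rec-start C = record { dfa = First.first C ; accepts = First.first⇔ C }

      rec-end : (C : L → Set) → Rec (λ ν _ j → C (ν j))
      rec-end C = record { dfa = Last.last C ; accepts = Last.last⇔ C }

      rec-const : ∀ C → Rec (λ _ _ _ → C)
      rec-const C = rec-start (λ _ → C)

      rec-⇒ : Rec P → Rec Q → Rec (λ ν i j → P ν i j → Q ν i j)
      rec-⇒ p q = record
        { dfa     = Implication.implication (dfa p) (dfa q)
        ; accepts = λ i≤j → let h = Implication.implication⇔ (dfa p) (dfa q) i≤j in mk⇔
            (λ x → to (accepts q i≤j) ∘ to h x ∘ from (accepts p i≤j))
            (λ f → from h (from (accepts q i≤j) ∘ f ∘ to (accepts p i≤j))) }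

      rec-¬ : Rec P → Rec (λ ν i j → ¬ P ν i j)
      rec-¬ p = rec-⇒ p (rec-const ⊥)

      rec-× : Rec P → Rec Q → Rec (λ ν i j → P ν i j × Q ν i j)
      rec-× p q = rec-cong
        (λ _ → mk⇔ (λ h → by-contradiction (λ ¬p → h (λ p _ → ¬p p)) , by-contradiction (λ ¬q → h (λ _ → ¬q)))
                   (λ (p , q) h → h p q))
        (rec-¬ (rec-⇒ p (rec-¬ q)))

      rec-∀ : ∀ {Z} → Finite Z → {P : Z → (ℤ → L) → ℤ → ℤ → Set} → (∀ z → Rec (P z)) →
              Rec (λ ν i j → ∀ z → P z ν i j)
      rec-∀ {Z} F {P} r =
        rec-cong (λ _ → mk⇔ (λ ps z → All.lookup ps (complete F z)) (λ f → All.universal f _)) (go (enum F))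
        where
        go : (zs : List Z) → Rec (λ ν i j → All (λ z → P z ν i j) zs)
        go []       = rec-cong (λ _ → mk⇔ (λ _ → []) _) (rec-const ⊤)
        go (z ∷ zs) = rec-cong (λ _ → mk⇔ (λ (p , ps) → p ∷ ps) (λ { (p ∷ ps) → p , ps })) (rec-× (r z) (go zs))

      rec-○ : Rec P → Rec (λ ν i j → i < j × P ν (sucℤ i) j)
      rec-○ p = record
        { dfa     = Next.next-dfa (dfa p)
        ; accepts = λ _ → let h = Next.next⇔ (dfa p) in mk⇔
            (λ x → let lt , y = to h x in lt , to (accepts p (ℤ.i<j⇒suc[i]≤j lt)) y)
            (λ (lt , y) → from h (lt , from (accepts p (ℤ.i<j⇒suc[i]≤j lt)) y)) }

      rec-⨾ : Rec P → Rec Q → Rec (λ ν i j → ∃[ k ] i ≤ k × k ≤ j × P ν i k × Q ν k j)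
      rec-⨾ p q = record
        { dfa     = Chop.chop (dfa p) (dfa q)
        ; accepts = λ _ → let h = Chop.chop⇔ (dfa p) (dfa q) in mk⇔
            (λ x → let k , l , l′ , y , z = to h x in k , l , l′ , to (accepts p l) y , to (accepts q l′) z)
            (λ (k , l , l′ , y , z) → from h (k , l , l′ , from (accepts p l) y , from (accepts q l′) z)) }

      rec-✶ : Rec P → Rec (λ ν → Star (λ i j → i < j × P ν i j))
      rec-✶ p = record
        { dfa     = Iteration.iteration (dfa p)
        ; accepts = λ _ → let h = Iteration.iteration⇔ (dfa p) in mk⇔
            (Star.map (λ (lt , y) → lt , to (accepts p (ℤ.<⇒≤ lt)) y) ∘ to h)
            (from h ∘ Star.map (λ (lt , y) → lt , from (accepts p (ℤ.<⇒≤ lt)) y)) }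

  -- Labellings of the integers and their acceptance conditions.

  module _ {V : Set} where

    -- An automaton on two-sided words whose runs are labellings. A literal `(v , f)` reads the
    -- value of `v` off a label by `f`; in place of accepting states, `segment d` judges finite
    -- stretches for the direction `d`.
    record Frame : Set₁ where
      no-eta-equality
      field
        Label      : Set
        finiteness : Finite Label
        literals   : List (V × (Label → Bool))
        edge       : Label → Label → Set
        segment    : Side → DFA Label

      Reads : Label → Pred V 0ℓ → Set
      Reads l a = All (λ (v , f) → T (f l) ⇔ a v) literals

      Seg : Side → (ℤ → Label) → ℤ → ℤ → Set
      Seg d ν = span d (Accepts (segment d) ν)

      Local : Seq V → (ℤ → Label) → Set
      Local σ ν = ∀ i → Reads (ν i) (σ i) × edge (ν i) (ν (sucℤ i))

      -- The segments certify that every obligation is met within a finite distance: some unbounded sequence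
      -- of checkpoints is enough to draw conclusions, but labellings are built so that every
      -- sufficiently long segment is good, which makes the condition stable under conjunction.
      Weak Strong : Seq V → (ℤ → Label) → Set
      Weak σ ν   = Local σ ν ×
        (∀ d → Σ[ k ∈ (ℕ → ℤ) ] (∀ a → k a <[ d ] k (suc a) × Seg d ν (k a) (k (suc a))))
      Strong σ ν = Local σ ν × (∀ d k → ∃[ K ] (∀ k′ → K ≤[ d ] k′ → Seg d ν k k′))

    open Frame

    free : {S : Set} → Finite S → Frame
    free {S} F = record
      { Label = S ; finiteness = F ; literals = [] ; edge = λ _ _ → ⊤
      ; segment = λ _ → dfa (rec-const ⊤) }
      where open Recognition F

    free-strong : ∀ {S} (F : Finite S) {σ} (ν : ℤ → S) → Strong (free F) σ ν
    free-strong F ν = (λ _ → [] , tt) , λ where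
        future k → k , λ _ le → from (accepts (rec-const ⊤) le) tt
        past   k → k , λ _ le → from (accepts (rec-const ⊤) le) tt
      where open Recognition F

    module _ {L : Set} (F : Finite L) where
      open Recognition F

      both : DFA L → DFA L → DFA L
      both D E = dfa (rec-× (rec-dfa D) (rec-dfa E))

      span-both : ∀ d D E {ν i j} → i ≤[ d ] j →
                  span d (Accepts (both D E) ν) i j ⇔ (span d (Accepts D ν) i j × span d (Accepts E ν) i j)
      span-both future D E = accepts (rec-× (rec-dfa D) (rec-dfa E))
      span-both past   D E = accepts (rec-× (rec-dfa D) (rec-dfa E))

    _⊗_ : Frame → Frame → Frame
    F ⊗ G = record
      { Label      = Label F × Label G
      ; finiteness = finiteness F ×-finite finiteness G
      ; literals   = map (λ (v , f) → v , f ∘ proj₁) (literals F) ++ map (λ (v , f) → v , f ∘ proj₂) (literals G)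
      ; edge       = λ (l , m) (l′ , m′) → edge F l l′ × edge G m m′
      ; segment    = λ d → both (finiteness F ×-finite finiteness G)
          (pull proj₁ (segment F d)) (pull proj₂ (segment G d)) }

    module _ (F G : Frame) {σ : Seq V} where

      ⊗-weak : ∀ {ν} → Weak (F ⊗ G) σ ν → Weak F σ (proj₁ ∘ ν) × Weak G σ (proj₂ ∘ ν)
      ⊗-weak {ν} (loc , segs) =
        ( (λ i → All.map⁻ (All.++⁻ˡ _ (proj₁ (loc i))) , proj₁ (proj₂ (loc i)))
        , λ d → let k , s = segs d in k , λ a → proj₁ (s a) ,
            span-map d (to (pull-accepts proj₁ (segment F d))) (proj₁ (split d (s a))) ) ,
        ( (λ i → All.map⁻ (All.++⁻ʳ (map _ (literals F)) (proj₁ (loc i))) , proj₂ (proj₂ (loc i)))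
        , λ d → let k , s = segs d in k , λ a → proj₁ (s a) ,
            span-map d (to (pull-accepts proj₂ (segment G d))) (proj₂ (split d (s a))) )
        where
        split : ∀ d {i j} → i <[ d ] j × Seg (F ⊗ G) d ν i j → _
        split d (lt , s) = to (span-both (finiteness (F ⊗ G)) d
          (pull proj₁ (segment F d)) (pull proj₂ (segment G d)) (<[]⇒≤[] d lt)) s

      -- Two sequences of checkpoints need not share a point, whereas two conditions that hold from
      -- some bound on both hold beyond the farther bound.
      ⊗-strong : ∀ {μ ν} → Strong F σ μ → Strong G σ ν → Strong (F ⊗ G) σ (λ i → μ i , ν i)
      ⊗-strong (loc , segs) (loc′ , segs′) =
        (λ i → All.++⁺ (All.map⁺ (proj₁ (loc i))) (All.map⁺ (proj₁ (loc′ i))) , proj₂ (loc i) , proj₂ (loc′ i)) ,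
        λ d k → let K , s = segs d k ; K′ , s′ = segs′ d k
                    M , K≤M , K′≤M = upper-bound d K K′ ; N , k≤N , M≤N = upper-bound d k M in
          N , λ k′ le → from (span-both (finiteness (F ⊗ G)) d
              (pull proj₁ (segment F d)) (pull proj₂ (segment G d)) (≤[]-trans d k≤N le))
            ( span-map d (from (pull-accepts proj₁ (segment F d))) (s k′ (≤[]-trans d K≤M (≤[]-trans d M≤N le)))
            , span-map d (from (pull-accepts proj₂ (segment G d))) (s′ k′ (≤[]-trans d K′≤M (≤[]-trans d M≤N le))) )

    module _ (F : Frame) (e : Label F → Label F → Set) (E : Side → DFA (Label F)) where

      refine : Frame
      refine = record
        { Label      = Label F
        ; finiteness = finiteness F
        ; literals   = literals F
        ; edge       = λ l m → edge F l m × e l m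
        ; segment    = λ d → both (finiteness F) (segment F d) (E d) }

      refine-weak : ∀ {σ ν} → Weak refine σ ν → Weak F σ ν × (∀ i → e (ν i) (ν (sucℤ i))) ×
                    (∀ d → Σ[ k ∈ (ℕ → ℤ) ] (∀ a → k a <[ d ] k (suc a) × span d (Accepts (E d) ν) (k a) (k (suc a))))
      refine-weak {ν = ν} (loc , segs) =
        ( (λ i → proj₁ (loc i) , proj₁ (proj₂ (loc i)))
        , λ d → let k , s = segs d in k , λ a → proj₁ (s a) , proj₁ (split d (s a)) ) ,
        (λ i → proj₂ (proj₂ (loc i))) ,
        λ d → let k , s = segs d in k , λ a → proj₁ (s a) , proj₂ (split d (s a))
        where
        split : ∀ d {i j} → i <[ d ] j × Seg refine d ν i j → _
        split d (lt , s) = to (span-both (finiteness F) d (segment F d) (E d) (<[]⇒≤[] d lt)) s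

      refine-strong : ∀ {σ ν} → Strong F σ ν → (∀ i → e (ν i) (ν (sucℤ i))) →
                      (∀ d k → ∃[ K ] (∀ k′ → K ≤[ d ] k′ → span d (Accepts (E d) ν) k k′)) → Strong refine σ ν
      refine-strong (loc , segs) loc′ segs′ =
        (λ i → proj₁ (loc i) , proj₂ (loc i) , loc′ i) ,
        λ d k → let K , s = segs d k ; K′ , s′ = segs′ d k
                    M , K≤M , K′≤M = upper-bound d K K′ ; N , k≤N , M≤N = upper-bound d k M in
          N , λ k′ le → from (span-both (finiteness F) d (segment F d) (E d) (≤[]-trans d k≤N le))
            (s k′ (≤[]-trans d K≤M (≤[]-trans d M≤N le)) , s′ k′ (≤[]-trans d K′≤M (≤[]-trans d M≤N le)))

    -- The asymmetry drives the induction: every weak labelling must be right about `A`, and some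
    -- strong labelling must exist. A labelling for a compound formula then contains correct
    -- labellings for its parts, and `main` combines their verdicts.
    record Aut (A : Formula V) : Set₁ where
      no-eta-equality
      field
        frame     : Frame
        literals⊆ : All (λ (v , _) → v ∈ Var A) (literals frame)
        main      : DFA (Label frame)
        sound     : ∀ {σ ν} → Weak frame σ ν → ∀ {i j} → i ≤ j → Accepts main ν i j ⇔ (σ , i , j ⊨ A)
        inhabited : ∀ σ → ∃[ ν ] Strong frame σ ν

    open Aut

    -- The automaton of each formula.

    aut-ff : Aut ff
    aut-ff = record
      { frame     = free ⊤-finite
      ; literals⊆ = []
      ; main      = dfa (rec-const ⊥)
      ; sound     = λ _ → accepts (rec-const ⊥)
      ; inhabited = λ _ → _ , free-strong ⊤-finite _ }
      where open Recognition ⊤-finite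

    aut-var : ∀ q → Aut (var q)
    aut-var q = record
      { frame     = F
      ; literals⊆ = refl ∷ []
      ; main      = dfa (rec-start T)
      ; sound     = λ {σ} (loc , _) {i} i≤j → let h = All.lookup (proj₁ (loc i)) (here refl) in
          mk⇔ (to h ∘ to (accepts (rec-start T) i≤j)) (from (accepts (rec-start T) i≤j) ∘ from h)
      ; inhabited = λ σ → (λ i → does (em {σ i q})) ,
          (λ _ → T-does em ∷ [] , tt) , proj₂ (free-strong Bool-finite {σ} _) }
      where
      open Recognition Bool-finite
      F : Frame
      F = record (free Bool-finite) { literals = (q , id) ∷ [] }

    module _ {A B : Formula V} (a : Aut A) (b : Aut B) where

      private
        F : Frame
        F = frame a ⊗ frame b
        open Recognition (finiteness F)
        left right : DFA (Label F)
        left  = pull proj₁ (main a)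
        right = pull proj₂ (main b)

        left⇔ : ∀ {σ ν} → Weak F σ ν → ∀ {i j} → i ≤ j → Accepts left ν i j ⇔ (σ , i , j ⊨ A)
        left⇔ w i≤j = let h = sound a (proj₁ (⊗-weak (frame a) (frame b) w)) i≤j ; g = pull-accepts proj₁ (main a) in
          mk⇔ (to h ∘ to g) (from g ∘ from h)

        right⇔ : ∀ {σ ν} → Weak F σ ν → ∀ {i j} → i ≤ j → Accepts right ν i j ⇔ (σ , i , j ⊨ B)
        right⇔ w i≤j = let h = sound b (proj₂ (⊗-weak (frame a) (frame b) w)) i≤j ; g = pull-accepts proj₂ (main b) in
          mk⇔ (to h ∘ to g) (from g ∘ from h)

        F-literals⊆ : All (λ (v , _) → v ∈ Var A ⊎ v ∈ Var B) (literals F)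
        F-literals⊆ = All.++⁺ (All.map⁺ (All.map inj₁ (literals⊆ a))) (All.map⁺ (All.map inj₂ (literals⊆ b)))

        F-inhabited : ∀ σ → ∃[ ν ] Strong F σ ν
        F-inhabited σ = _ , ⊗-strong (frame a) (frame b) (proj₂ (inhabited a σ)) (proj₂ (inhabited b σ))

      aut-⊃ : Aut (A ⊃ B)
      aut-⊃ = record
        { frame     = F
        ; literals⊆ = F-literals⊆
        ; main      = dfa r
        ; sound     = λ w i≤j → mk⇔
            (λ x → case em of λ { (no ¬p) → inj₁ ¬p
                                ; (yes p) → inj₂ (to (right⇔ w i≤j) (to (accepts r i≤j) x (from (left⇔ w i≤j) p))) })
            (λ { (inj₁ ¬p) → from (accepts r i≤j) (λ p → contradiction (to (left⇔ w i≤j) p) ¬p)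
               ; (inj₂ q)  → from (accepts r i≤j) (λ _ → from (right⇔ w i≤j) q) })
        ; inhabited = F-inhabited }
        where
        r : Rec (λ ν i j → Accepts left ν i j → Accepts right ν i j)
        r = rec-⇒ (rec-dfa left) (rec-dfa right)

      aut-⨾ : Aut (A ⨾ B)
      aut-⨾ = record
        { frame     = F
        ; literals⊆ = F-literals⊆
        ; main      = dfa r
        ; sound     = λ w i≤j → mk⇔
            (λ x → let k , l , l′ , p , q = to (accepts r i≤j) x in k , l , l′ , to (left⇔ w l) p , to (right⇔ w l′) q)
            (λ (k , l , l′ , p , q) → from (accepts r i≤j) (k , l , l′ , from (left⇔ w l) p , from (right⇔ w l′) q))
        ; inhabited = F-inhabited }
        where
        r : Rec _
        r = rec-⨾ (rec-dfa left) (rec-dfa right)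

    module _ {A : Formula V} (a : Aut A) where

      private
        F : Frame
        F = frame a
        D : DFA (Label F)
        D = main a

      aut-○ : Aut (○ A)
      aut-○ = record
        { frame     = F
        ; literals⊆ = literals⊆ a
        ; inhabited = inhabited a
        ; main      = dfa r
        ; sound     = λ w i≤j → mk⇔
            (λ x → let lt , p = to (accepts r i≤j) x in lt , to (sound a w (ℤ.i<j⇒suc[i]≤j lt)) p)
            (λ (lt , p) → from (accepts r i≤j) (lt , from (sound a w (ℤ.i<j⇒suc[i]≤j lt)) p)) }
        where
        open Recognition (finiteness F)
        r : Rec _
        r = rec-○ (rec-dfa D)

      aut-✶ : Aut (A ✶)
      aut-✶ = record
        { frame     = F
        ; literals⊆ = literals⊆ a
        ; inhabited = inhabited a
        ; main      = dfa r
        ; sound     = λ {σ} w i≤j → mk⇔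
            (from (✶-Star {σ = σ} {A}) ∘ Star.map (λ (lt , p) → lt , to (sound a w (ℤ.<⇒≤ lt)) p) ∘ to (accepts r i≤j))
            (from (accepts r i≤j) ∘ Star.map (λ (lt , p) → lt , from (sound a w (ℤ.<⇒≤ lt)) p) ∘
              to (✶-Star {σ = σ} {A})) }
        where
        open Recognition (finiteness F)
        r : Rec _
        r = rec-✶ (rec-dfa D)

      private
        open Subsets (finite D)
        F⁺ : Frame
        F⁺ = F ⊗ free Sub-finite
        open Recognition (finiteness F⁺)

      -- The second component of a label at j is the set of states from which D accepts on some [ j , k ].
      aut-◇ᵣ : Aut (◇ᵣ A)
      aut-◇ᵣ = record
        { frame     = G
        ; literals⊆ = All.++⁺ (All.map⁺ (literals⊆ a)) []
        ; main      = dfa m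
        ; sound     = G-sound
        ; inhabited = G-inhabited }
        where
        -- The one-step equation of `Eventually`. It also has solutions in which acceptance is put
        -- off for ever; `r` excludes them by asking that every promise made at `i` be kept by `j`.
        e : Label F⁺ → Label F⁺ → Set
        e (_ , u) (l , u′) = ∀ s → s ∈ₛ u ⇔ (acc D s ⊎ step D s l ∈ₛ u′)

        starting : State D → DFA (Label F)
        starting s = record D { start = λ _ → s }

        r : Rec (λ ν i j → ∀ s → s ∈ₛ proj₂ (ν i) →
                   ∃[ k ] i ≤ k × k ≤ j × Accepts (pull proj₁ (starting s)) ν i k × ⊤)
        r = rec-∀ (finite D) λ s →
          rec-⇒ (rec-start (λ (_ , u) → s ∈ₛ u)) (rec-⨾ (rec-dfa (pull proj₁ (starting s))) (rec-const ⊤))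

        E : Side → DFA (Label F⁺)
        E future = dfa r
        E past   = dfa (rec-const ⊤)

        G : Frame
        G = refine F⁺ e E

        m : Rec (λ ν _ j → start D (proj₁ (ν j)) ∈ₛ proj₂ (ν j))
        m = rec-end (λ (l , u) → start D l ∈ₛ u)

        Eventually : (ℤ → Label F) → State D → ℤ → Set
        Eventually μ s j = ∃[ k ] j ≤ k × Accepts (starting s) μ j k

        unfold : ∀ {μ s j} → Eventually μ s j ⇔ (acc D s ⊎ Eventually μ (step D s (μ (sucℤ j))) (sucℤ j))
        unfold = mk⇔
          (λ { (_ , _ , _ , [] , x)       → inj₁ x
             ; (k , _ , _ , next ∷ p , x) → inj₂ (k , path-≤ p , _ , p , x) })
          (λ { (inj₁ x)                   → _ , ℤ.≤-refl , _ , [] , x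
             ; (inj₂ (k , l , _ , p , x)) → k , ℤ.≤-trans (ℤ.i≤suc[i] _) l , _ , next ∷ p , x })

        G-sound : ∀ {σ ν} → Weak G σ ν → ∀ {i j} → i ≤ j → Accepts (dfa m) ν i j ⇔ (σ , i , j ⊨ (◇ᵣ A))
        G-sound {σ} {ν} w {i} {j} i≤j = mk⇔
          (λ x → let k , l , p = complete⇒ j _ (to (accepts m i≤j) x) in k , l , to (sound a wF l) p)
          (λ (k , l , p) → let _ , run , x = from (sound a wF l) p in from (accepts m i≤j) (sound⇒ run x))
          where
          μ : ℤ → Label F
          μ = proj₁ ∘ ν
          wF : Weak F σ μ
          wF = proj₁ (⊗-weak F (free Sub-finite) (proj₁ (refine-weak F⁺ e E w)))
          edges : ∀ i → e (ν i) (ν (sucℤ i))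
          edges = proj₁ (proj₂ (refine-weak F⁺ e E w))
          segs : ∀ d → Σ[ k ∈ (ℕ → ℤ) ] (∀ a → k a <[ d ] k (suc a) × span d (Accepts (E d) ν) (k a) (k (suc a)))
          segs = proj₂ (proj₂ (refine-weak F⁺ e E w))

          sound⇒ : ∀ {j s k t} → DFA.Run D μ j s k t → acc D t → s ∈ₛ proj₂ (ν j)
          sound⇒ []         x = from (edges _ _) (inj₁ x)
          sound⇒ (next ∷ p) x = from (edges _ _) (inj₂ (sound⇒ p x))

          -- At a checkpoint beyond `j` all promises are known to be kept, and the equation `e`
          -- carries this back to `j` one step at a time.
          complete⇒ : ∀ j s → s ∈ₛ proj₂ (ν j) → Eventually μ s j
          complete⇒ j = ≤-induction-down (λ j → ∀ s → s ∈ₛ proj₂ (ν j) → Eventually μ s j) checkpoint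
            (λ _ ih s s∈ → from unfold (Sum.map₂ (ih _) (to (edges _ s) s∈))) (proj₂ bound)
            where
            k : ℕ → ℤ
            k = proj₁ (segs future)
            seg : ∀ a → k a < k (suc a) × Accepts (E future) ν (k a) (k (suc a))
            seg = proj₂ (segs future)
            bound : ∃[ a ] j ≤ k a
            bound = unbounded future k (proj₁ ∘ seg) j
            c : ℕ
            c = proj₁ bound
            checkpoint : ∀ s → s ∈ₛ proj₂ (ν (k c)) → Eventually μ s (k c)
            checkpoint s s∈ =
              let n , l , _ , x , _ = to (accepts r (ℤ.<⇒≤ (proj₁ (seg c)))) (proj₂ (seg c)) s s∈ in
              n , l , to (pull-accepts proj₁ (starting s)) x

        G-inhabited : ∀ σ → ∃[ ν ] Strong G σ ν
        G-inhabited σ with inhabited a σ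
        ... | μ , strong = ν , refine-strong F⁺ e E (⊗-strong F (free Sub-finite) strong (free-strong Sub-finite U))
            (λ i s → mk⇔ (Sum.map₂ (from ∈⟦⟧) ∘ to unfold ∘ to ∈⟦⟧) (from ∈⟦⟧ ∘ from unfold ∘ Sum.map₂ (to ∈⟦⟧)))
            segs
          where
          U : ℤ → Sub
          U i = ⟦ (λ s → Eventually μ s i) ⟧
          ν : ℤ → Label F⁺
          ν i = μ i , U i
          segs : ∀ d k → ∃[ K ] (∀ k′ → K ≤[ d ] k′ → span d (Accepts (E d) ν) k k′)
          segs past   k = k , λ _ le → from (accepts (rec-const ⊤) le) tt
          segs future k with common-bound future (finite D) (λ s k′ → k ≤ k′ → s ∈ₛ U k →
              ∃[ n ] k ≤ n × n ≤ k′ × Accepts (pull proj₁ (starting s)) ν k n × ⊤) met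
            where
            met : ∀ s → ∃[ K ] (∀ k′ → K ≤ k′ → k ≤ k′ → s ∈ₛ U k →
                    ∃[ n ] k ≤ n × n ≤ k′ × Accepts (pull proj₁ (starting s)) ν k n × ⊤)
            met s with em {Eventually μ s k}
            ... | yes (n , l , x) = n , λ _ le _ _ → n , l , le , from (pull-accepts proj₁ (starting s)) x , tt
            ... | no ¬x           = k , λ _ _ _ s∈ → contradiction (to ∈⟦⟧ s∈) ¬x
          ... | K , h = K ⊔ k , λ k′ le → let k≤k′ = ℤ.≤-trans (ℤ.i≤j⊔i K k) le in
            from (accepts r k≤k′) (λ s → h k′ (ℤ.≤-trans (ℤ.i≤i⊔j K k) le) s k≤k′)

      -- The second component of a label at i is the set of states that D reaches on some [ k , i ].
      aut-◇ₗ : Aut (◇ₗ A)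
      aut-◇ₗ = record
        { frame     = G
        ; literals⊆ = All.++⁺ (All.map⁺ (literals⊆ a)) []
        ; main      = dfa m
        ; sound     = G-sound
        ; inhabited = G-inhabited }
        where
        -- This determines `u′` from `u`, but the line has no first point, so a state might be
        -- handed down from minus infinity without any reading that begins it. The segments on the
        -- past side exclude this.
        e : Label F⁺ → Label F⁺ → Set
        e (_ , u) (l , u′) = ∀ t → t ∈ₛ u′ ⇔ (t ≡ start D l ⊎ ∃[ s ] s ∈ₛ u × t ≡ step D s l)

        ending : State D → DFA (Label F)
        ending t = record D { acc = _≡ t }

        r : Rec (λ ν i j → ∀ t → t ∈ₛ proj₂ (ν j) →
                   ∃[ k ] i ≤ k × k ≤ j × ⊤ × Accepts (pull proj₁ (ending t)) ν k j)
        r = rec-∀ (finite D) λ t →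
          rec-⇒ (rec-end (λ (_ , u) → t ∈ₛ u)) (rec-⨾ (rec-const ⊤) (rec-dfa (pull proj₁ (ending t))))

        E : Side → DFA (Label F⁺)
        E future = dfa (rec-const ⊤)
        E past   = dfa r

        G : Frame
        G = refine F⁺ e E

        m : Rec (λ ν i _ → ∃[ t ] t ∈ₛ proj₂ (ν i) × acc D t)
        m = rec-start (λ (_ , u) → ∃[ t ] t ∈ₛ u × acc D t)

        Reached : (ℤ → Label F) → State D → ℤ → Set
        Reached μ t i = ∃[ k ] k ≤ i × DFA.Run D μ k (start D (μ k)) i t

        unfold : ∀ {μ t i} → Reached μ t (sucℤ i) ⇔
                 (t ≡ start D (μ (sucℤ i)) ⊎ ∃[ s ] Reached μ s i × t ≡ step D s (μ (sucℤ i)))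
        unfold {μ} {t} {i} = mk⇔ forward
          (λ { (inj₁ refl)                    → _ , ℤ.≤-refl , []
             ; (inj₂ (_ , (k , l , p) , refl)) → k , ℤ.≤-trans l (ℤ.i≤suc[i] i) , snoc p next })
          where
          forward : Reached μ t (sucℤ i) → _
          forward (k , l , p) with k ℤ.≟ sucℤ i
          ... | yes refl = inj₁ (sym (path-nil p refl))
          ... | no k≢ with ℤ.i<j⇒i≤pred[j] (ℤ.≤∧≢⇒< l k≢)
          ... | k≤ with subst (k ≤_) (ℤ.pred-suc i) k≤
          ... | k≤i with path-unsnoc k≤i p
          ... | _ , q , next = inj₂ (_ , (k , k≤i , q) , refl)

        G-sound : ∀ {σ ν} → Weak G σ ν → ∀ {i j} → i ≤ j → Accepts (dfa m) ν i j ⇔ (σ , i , j ⊨ (◇ₗ A))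
        G-sound {σ} {ν} w {i} {j} i≤j = mk⇔
          (λ x → let _ , t∈ , y = to (accepts m i≤j) x ; k , l , p = complete⇒ i _ t∈ in
             k , l , to (sound a wF l) (_ , p , y))
          (λ (k , l , p) → let _ , run , x = from (sound a wF l) p in
             from (accepts m i≤j) (_ , path-preserves (λ i t → t ∈ₛ proj₂ (ν i)) advance run (initial k) , x))
          where
          μ : ℤ → Label F
          μ = proj₁ ∘ ν
          wF : Weak F σ μ
          wF = proj₁ (⊗-weak F (free Sub-finite) (proj₁ (refine-weak F⁺ e E w)))
          edges : ∀ i → e (ν i) (ν (sucℤ i))
          edges = proj₁ (proj₂ (refine-weak F⁺ e E w))
          segs : ∀ d → Σ[ k ∈ (ℕ → ℤ) ] (∀ a → k a <[ d ] k (suc a) × span d (Accepts (E d) ν) (k a) (k (suc a)))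
          segs = proj₂ (proj₂ (refine-weak F⁺ e E w))

          initial : ∀ k → start D (μ k) ∈ₛ proj₂ (ν k)
          -- `e` describes the set at a successor only, so `k` is taken as the successor of
          -- `pred k`.
          initial k = subst (λ k → start D (μ k) ∈ₛ proj₂ (ν k)) (ℤ.suc-pred k) (from (edges (pred k) _) (inj₁ refl))

          advance : ∀ {i s t} → s ∈ₛ proj₂ (ν i) → Step (step D) μ i s t → t ∈ₛ proj₂ (ν (sucℤ i))
          advance s∈ next = from (edges _ _) (inj₂ (_ , s∈ , refl))

          complete⇒ : ∀ i t → t ∈ₛ proj₂ (ν i) → Reached μ t i
          complete⇒ i = ≤-induction (λ i → ∀ t → t ∈ₛ proj₂ (ν i) → Reached μ t i) checkpoint
            (λ _ ih t t∈ → from unfold (Sum.map₂ (λ (s , s∈ , eq) → s , ih s s∈ , eq) (to (edges _ t) t∈))) (proj₂ bound)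
            where
            k : ℕ → ℤ
            k = proj₁ (segs past)
            seg : ∀ a → k (suc a) < k a × Accepts (E past) ν (k (suc a)) (k a)
            seg = proj₂ (segs past)
            bound : ∃[ a ] k a ≤ i
            bound = unbounded past k (proj₁ ∘ seg) i
            c : ℕ
            c = proj₁ bound
            checkpoint : ∀ t → t ∈ₛ proj₂ (ν (k c)) → Reached μ t (k c)
            checkpoint t t∈ =
              let n , _ , l , _ , x = to (accepts r (ℤ.<⇒≤ (proj₁ (seg c)))) (proj₂ (seg c)) t t∈
                  _ , p , eq = to (pull-accepts proj₁ (ending t)) x in
              n , l , subst (λ t → DFA.Run D μ n (start D (μ n)) (k c) t) eq p

        G-inhabited : ∀ σ → ∃[ ν ] Strong G σ ν
        G-inhabited σ with inhabited a σ
        ... | μ , strong = ν , refine-strong F⁺ e E (⊗-strong F (free Sub-finite) strong (free-strong Sub-finite U))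
            (λ i t → mk⇔ (Sum.map₂ (λ (s , x , eq) → s , from ∈⟦⟧ x , eq) ∘ to unfold ∘ to ∈⟦⟧)
                         (from ∈⟦⟧ ∘ from unfold ∘ Sum.map₂ (λ (s , s∈ , eq) → s , to ∈⟦⟧ s∈ , eq)))
            segs
          where
          U : ℤ → Sub
          U i = ⟦ (λ t → Reached μ t i) ⟧
          ν : ℤ → Label F⁺
          ν i = μ i , U i
          segs : ∀ d k → ∃[ K ] (∀ k′ → K ≤[ d ] k′ → span d (Accepts (E d) ν) k k′)
          segs future k = k , λ _ le → from (accepts (rec-const ⊤) le) tt
          segs past   k with common-bound past (finite D) (λ t k′ → t ∈ₛ U k →
              ∃[ n ] k′ ≤ n × n ≤ k × ⊤ × Accepts (pull proj₁ (ending t)) ν n k) met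
            where
            met : ∀ t → ∃[ K ] (∀ k′ → k′ ≤ K → t ∈ₛ U k →
                    ∃[ n ] k′ ≤ n × n ≤ k × ⊤ × Accepts (pull proj₁ (ending t)) ν n k)
            met t with em {Reached μ t k}
            ... | yes (n , l , p) = n , λ _ le _ → n , le , l , tt , from (pull-accepts proj₁ (ending t)) (_ , p , refl)
            ... | no ¬x           = k , λ _ _ t∈ → contradiction (to ∈⟦⟧ t∈) ¬x
          ... | K , h = K ⊓ k , λ k′ le →
            from (accepts r (ℤ.≤-trans le (ℤ.i⊓j≤j K k))) (h k′ (ℤ.≤-trans le (ℤ.i⊓j≤i K k)))

    abstract
      automaton : ∀ A → Aut A
      automaton ff      = aut-ff
      automaton (var q) = aut-var q
      automaton (A ⊃ B) = aut-⊃ (automaton A) (automaton B)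
      automaton (○ A)   = aut-○ (automaton A)
      automaton (A ⨾ B) = aut-⨾ (automaton A) (automaton B)
      automaton (A ✶)   = aut-✶ (automaton A)
      automaton (◇ₗ A)  = aut-◇ₗ (automaton A)
      automaton (◇ᵣ A)  = aut-◇ᵣ (automaton A)

  -- Recurrence, glueing and merging in finite colourings.

  module _ (d : Side) where

    Infinite : (ℤ → Set) → Set
    Infinite X = ∀ m → ∃[ n ] m <[ d ] n × X n

    infinite-pigeonhole : ∀ {Z} → Finite Z → {X : Z → ℤ → Set} →
                          Infinite (λ n → ∃[ z ] X z n) → ∃[ z ] Infinite (X z)
    infinite-pigeonhole F {X} inf = by-contradiction λ none →
      let K , empty = common-bound d F (λ z n → ¬ X z n) (λ z → bounded (λ h → none (z , h)))
          n , K<n , z , x = inf K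
      in empty n (<[]⇒≤[] d K<n) z x
      where
      bounded : ∀ {Y} → ¬ Infinite Y → ∃[ K ] (∀ k → K ≤[ d ] k → ¬ Y k)
      bounded ¬inf = by-contradiction λ h → ¬inf λ m → by-contradiction λ h′ →
        let m′ , m<m′ = beyond d m in
        h (m′ , λ k le y → h′ (k , ≤[]-<[]-trans′ m<m′ le , y))
        where
        ≤[]-<[]-trans′ : ∀ {i j k} → i <[ d ] j → j ≤[ d ] k → i <[ d ] k
        ≤[]-<[]-trans′ lt le = ≰[]⇒>[] d (λ le′ → <[]⇒≱[] d lt (≤[]-trans d le le′))

    module _ {k : ℕ → ℤ} (k< : ∀ a → k a <[ d ] k (suc a)) where

      increasing : ∀ {a b} → a ℕ.≤ b → k a ≤[ d ] k b
      increasing a≤b = go (ℕ.≤⇒≤′ a≤b)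
        where
        go : ∀ {a b} → a ℕ.≤′ b → k a ≤[ d ] k b
        go (ℕ.≤′-reflexive refl) = ≤[]-refl d
        go (ℕ.≤′-step a≤b)       = ≤[]-trans d (go a≤b) (<[]⇒≤[] d (k< _))

      locate : ∀ {z} → k 0 ≤[ d ] z → ∃[ a ] k a ≤[ d ] z × z <[ d ] k (suc a)
      locate {z} k0≤z with unbounded d k k< z
      ... | b , z≤kb = go b (≤[]-<[]-trans d z≤kb (k< b))
        where
        go : ∀ b → z <[ d ] k (suc b) → ∃[ a ] k a ≤[ d ] z × z <[ d ] k (suc a)
        go zero    lt = 0 , k0≤z , lt
        go (suc b) lt with em {k (suc b) ≤[ d ] z}
        ... | yes le = suc b , le , lt
        ... | no ¬le = go b (≰[]⇒>[] d ¬le)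

      module _ {Y : Set} (g : ℕ → ℤ → Y) (joint : ∀ a → g a (k (suc a)) ≡ g (suc a) (k (suc a))) where

        abstract
          glue : Σ[ h ∈ (ℤ → Y) ] (∀ a z → k a ≤[ d ] z → z ≤[ d ] k (suc a) → h z ≡ g a z)
          glue = h , agrees
            where
            h : ℤ → Y
            h z with em {k 0 ≤[ d ] z}
            ... | yes le = g (proj₁ (locate le)) z
            -- No value is prescribed before `k 0`; this one is arbitrary.
            ... | no _   = g 0 z
            agrees : ∀ a z → k a ≤[ d ] z → z ≤[ d ] k (suc a) → h z ≡ g a z
            agrees a z ka≤z z≤ka⁺ with em {k 0 ≤[ d ] z}
            ... | no ¬le = contradiction (≤[]-trans d (increasing ℕ.z≤n) ka≤z) ¬le
            ... | yes le with locate le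
            ... | b , kb≤z , z<kb⁺ with ℕ.<-cmp a b
            ... | tri≈ _ refl _ = refl
            ... | tri> _ _ b<a  = contradiction (≤[]-trans d (increasing b<a) ka≤z) (<[]⇒≱[] d z<kb⁺)
            ... | tri< a<b _ _ with ℕ.m≤n⇒m<n∨m≡n a<b
            ... | inj₁ a⁺<b =
              contradiction (≤[]-trans d (increasing a⁺<b) (≤[]-trans d kb≤z z≤ka⁺)) (<[]⇒≱[] d (k< (suc a)))
            -- Consecutive pieces overlap in their common end alone, where `joint` makes them agree.
            ... | inj₂ refl with ≤[]-antisym d z≤ka⁺ kb≤z
            ... | refl = sym (joint a)

    module Colouring {Colour : Set} (c : ℤ → ℤ → Colour) where

      Merge : ℤ → ℤ → Set
      Merge k n = ∃[ l ] n ≤[ d ] l × c k l ≡ c n l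

      -- Replaces the sequence that `Factorises` asks for by conditions on one later point at a
      -- time, which a formula can express.
      Lim : Colour → ℤ → Set
      Lim e k = ∀ m → k ≤[ d ] m → ∃[ n ] m <[ d ] n × c k n ≡ e × Merge k n

      Factorises : Colour → ℤ → Set
      Factorises e k = Σ[ f ∈ (ℕ → ℤ) ] f 0 ≡ k × (∀ a → f a <[ d ] f (suc a) × c (f a) (f (suc a)) ≡ e)

      -- Once the colours from k and from a merged point n agree, they agree for ever, so the next
      -- point whose colour from k is e also has colour e from n.
      Lim⇒Factorises : (∀ {k n m l} → k ≤[ d ] m → n ≤[ d ] m → m ≤[ d ] l → c k m ≡ c n m → c k l ≡ c n l) →
                       ∀ {e k} → Lim e k → Factorises e k
      Lim⇒Factorises extend {e} {k} lim = proj₁ ∘ points , refl , λ a → proj₂ (advance (points a))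
        where
        Point : Set
        Point = ∃[ n ] k ≤[ d ] n × Merge k n
        advance : (p : Point) → Σ[ q ∈ Point ] proj₁ p <[ d ] proj₁ q × c (proj₁ p) (proj₁ q) ≡ e
        advance (n , k≤n , l , n≤l , eq) =
          let k≤l = ≤[]-trans d k≤n n≤l ; n′ , l<n′ , e≡ , merge = lim l k≤l ; l≤n′ = <[]⇒≤[] d l<n′ in
          (n′ , ≤[]-trans d k≤l l≤n′ , merge) , ≤[]-<[]-trans d n≤l l<n′ , trans (sym (extend k≤l n≤l l≤n′ eq)) e≡
        points : ℕ → Point
        points zero    = k , ≤[]-refl d , k , ≤[]-refl d , refl
        points (suc a) = proj₁ (advance (points a))

      module _ (F : Finite Colour) {X : ℤ → Set} (inf : Infinite X) where

        -- Points that never merge pairwise have pairwise distinct colours at any later point.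
        merging-class : ∃[ k ] X k × Infinite (λ n → X n × Merge k n)
        merging-class = by-contradiction λ none →
          let bound : ∀ k → X k → ∃[ K ] (∀ n → K <[ d ] n → X n → ¬ Merge k n)
              bound k x = by-contradiction λ h → none (k , x , λ m → by-contradiction λ h′ →
                h (m , λ n lt x′ mg → h′ (n , lt , x′ , mg)))
          in impossible bound
          where
          impossible : (∀ k → X k → ∃[ K ] (∀ n → K <[ d ] n → X n → ¬ Merge k n)) → ⊥
          impossible bound = clash (pigeonhole ℕ.≤-refl colour)
            where
            Chosen : Set
            Chosen = ∃[ k ] X k × ∃[ B ] (∀ n → B <[ d ] n → X n → ¬ Merge k n)
            make : ℤ → Chosen
            -- The new bound `M` lies beyond the old one as well, so each later choice is beyond the
            -- bounds of all earlier points and merges with none of them.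
            make B = let n , _ , x = inf B ; K , h = bound n x ; M , B≤M , K≤M = upper-bound d B K in
              n , x , M , λ n lt → h n (≤[]-<[]-trans d K≤M lt)
            states : ℕ → Chosen
            states zero    = make (+ 0)
            states (suc a) = make (proj₁ (proj₂ (proj₂ (states a))))
            g B : ℕ → ℤ
            g = proj₁ ∘ states
            B a = proj₁ (proj₂ (proj₂ (states a)))
            B-step : ∀ a → B a ≤[ d ] B (suc a)
            B-step a = proj₁ (proj₂ (upper-bound d (B a) _))
            B-mono : ∀ {a b} → a ℕ.≤′ b → B a ≤[ d ] B b
            B-mono (ℕ.≤′-reflexive refl) = ≤[]-refl d
            B-mono {b = suc b} (ℕ.≤′-step a≤b) = ≤[]-trans d (B-mono a≤b) (B-step b)
            separated : ∀ {a b} → a ℕ.< b → ¬ Merge (g a) (g b)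
            separated {a} {suc b} a<b = proj₂ (proj₂ (proj₂ (states a))) _
              (≤[]-<[]-trans d (B-mono (ℕ.≤⇒≤′ (ℕ.s≤s⁻¹ a<b))) (proj₁ (proj₂ (inf (B b)))))
              (proj₁ (proj₂ (states (suc b))))
            N : ℕ
            N = length (enum F)
            end : ∃[ l ] (∀ k → l ≤[ d ] k → ∀ (a : Fin (suc N)) → g (toℕ a) ≤[ d ] k)
            end = common-bound d Fin-finite (λ a k → g (toℕ a) ≤[ d ] k) (λ a → g (toℕ a) , λ _ le → le)
              where
              Fin-finite : Finite (Fin (suc N))
              Fin-finite = record { enum = List.allFin _ ; complete = ∈-allFin }
            colour : Fin (suc N) → Fin N
            colour a = index (complete F (c (g (toℕ a)) (proj₁ end)))
            clash : ∃[ a ] ∃[ b ] a Fin.< b × colour a ≡ colour b → ⊥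
            clash (a , b , a<b , eq) = separated a<b (proj₁ end , proj₂ end _ (≤[]-refl d) b ,
              trans (lookup-index (complete F _))
                (trans (cong (List.lookup (enum F)) eq) (sym (lookup-index (complete F _)))))

        -- Pigeonhole on the colours from `k` within its merging class. The recurring points stay in
        -- `X`, so a property such as carrying a given label can be fixed beforehand.
        limit-point : ∃[ k ] ∃[ e ] X k × Infinite (λ n → k ≤[ d ] n × X n × c k n ≡ e × Merge k n)
        limit-point =
          let k , x , inf′ = merging-class
              e , inf″ = infinite-pigeonhole F {λ e n → k ≤[ d ] n × X n × c k n ≡ e × Merge k n} λ m →
                let m′ , m≤m′ , k≤m′ = upper-bound d m k ; n , lt , x′ , merge = inf′ m′ in
                n , ≤[]-<[]-trans d m≤m′ lt , c k n , ≤[]-trans d k≤m′ (<[]⇒≤[] d lt) , x′ , refl , merge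
          in k , e , x , inf″

  -- Recurrence of transition colours as a formula.

  module Limits {V : Set} (X : Pred V 0ℓ) {S : Set} (F : Finite S) (δ : Pred V 0ℓ → S → S → Set)
                (def-δ : ∀ x y → Definability.Def X (λ σ i j → δ (σ i) x y)) where

    open Definability X
    open Kleene F δ def-δ public using (Trace; def-Trace)
    open Subsets (F ×-finite F) public

    colour : Seq V → ℤ → ℤ → Sub
    colour σ i j = ⟦ (λ (x , y) → Trace σ i x j y) ⟧

    infixr 6 _∙_
    _∙_ : Sub → Sub → Sub
    u ∙ v = ⟦ (λ (x , z) → ∃[ y ] (x , y) ∈ₛ u × (y , z) ∈ₛ v) ⟧

    colour-∙ : ∀ {σ i k j} → i ≤ k → k ≤ j → colour σ i j ≡ colour σ i k ∙ colour σ k j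
    colour-∙ i≤k k≤j = ⟦⟧-cong λ _ → mk⇔
      (λ p → let y , q , r = path-split i≤k k≤j p in y , from ∈⟦⟧ q , from ∈⟦⟧ r)
      (λ (_ , q , r) → to ∈⟦⟧ q ++ₚ to ∈⟦⟧ r)

    def-colour : ∀ u → Def (λ σ i j → colour σ i j ≡ u)
    def-colour = def-⟦⟧ (F ×-finite F) (λ (x , y) → def-Trace x y)

    prod : Side → Sub → Sub → Sub
    prod d = span d _∙_

    colour-prod : ∀ d {σ i k j} → i ≤[ d ] k → k ≤[ d ] j →
                  span d (colour σ) i j ≡ prod d (span d (colour σ) i k) (span d (colour σ) k j)
    colour-prod future p q = colour-∙ p q
    colour-prod past   p q = colour-∙ q p

    module Lims d σ = Colouring d (span d (colour σ))
    open Lims public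

    colour-extend : ∀ d {σ k n m l} → k ≤[ d ] m → n ≤[ d ] m → m ≤[ d ] l →
                    span d (colour σ) k m ≡ span d (colour σ) n m → span d (colour σ) k l ≡ span d (colour σ) n l
    colour-extend d k≤m n≤m m≤l eq =
      trans (colour-prod d k≤m m≤l) (trans (cong (λ u → prod d u _) eq) (sym (colour-prod d n≤m m≤l)))

    Recurs Recurs′ : Side → Sub → Seq V → ℤ → ℤ → Set
    Recurs d e σ k m = ∃[ n ] m <[ d ] n × span d (colour σ) k n ≡ e × Merge d σ k n
    Recurs′ d e σ k m = ∃[ t ] ∃[ v ] ∃[ u ] (prod d t v ≡ e × prod d e u ≡ u) × span d (colour σ) k m ≡ t ×
      (∃[ n ] m ≤[ d ] n × m <[ d ] n × span d (colour σ) m n ≡ v × (∃[ l ] n ≤[ d ] l × span d (colour σ) n l ≡ u))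

    -- Colours from k are reduced to colours from later points, the only ones that ◇ᵣ and ◇ₗ can see.
    recurs⇔ : ∀ d {e σ k m} → k ≤[ d ] m → Recurs′ d e σ k m ⇔ Recurs d e σ k m
    recurs⇔ d {e} {σ} {k} k≤m = mk⇔
      (λ { (_ , _ , _ , (tv , eu) , refl , n , m≤n , m<n , refl , l , n≤l , refl) →
           let e≡ = trans (colour-prod d k≤m m≤n) tv ; k≤n = ≤[]-trans d k≤m m≤n in
           n , m<n , e≡ , l , n≤l , trans (colour-prod d k≤n n≤l) (trans (cong (λ z → prod d z _) e≡) eu) })
      (λ (n , m<n , e≡ , l , n≤l , eq) →
           let m≤n = <[]⇒≤[] d m<n ; k≤n = ≤[]-trans d k≤m m≤n in
           _ , _ , _ , (trans (sym (colour-prod d k≤m m≤n)) e≡ ,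
                        trans (cong (λ z → prod d z _) (sym e≡)) (trans (sym (colour-prod d k≤n n≤l)) eq)) ,
           refl , n , m≤n , m<n , refl , l , n≤l , refl)

    -- The box makes `k` and `m` the ends of the current interval, on which `t` is read; each inner
    -- `◇ᵣ` passes to an interval that begins where the previous one ends.
    def-Lim-future : ∀ e → Def (λ σ _ k → Lim future σ e k)
    def-Lim-future e = def-□ᵣ (def-cong (recurs⇔ future)
      (def-∃ Sub-finite λ t → def-∃ Sub-finite λ v → def-∃ Sub-finite λ u →
        def-× (def-const _) (def-× (def-colour t)
          (def-◇ᵣ (def-× def-< (def-× (def-colour v) (def-◇ᵣ (def-colour u))))))))

    def-Lim-past : ∀ e → Def (λ σ k _ → Lim past σ e k)
    def-Lim-past e = def-□ₗ (def-cong (recurs⇔ past)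
      (def-∃ Sub-finite λ t → def-∃ Sub-finite λ v → def-∃ Sub-finite λ u →
        def-× (def-const _) (def-× (def-colour t)
          (def-◇ₗ (def-× def-< (def-× (def-colour v) (def-◇ₗ (def-colour u))))))))

  -- The universal modality, renaming, and change of one variable.

  module _ {V : Set} where

    private variable A : Formula V

    ◇ₐ-sem : ∀ {σ : Seq V} {i j} → (σ , i , j ⊨ (◇ₐ A)) ⇔ (∃[ k ] ∃[ l ] k ≤ l × (σ , k , l ⊨ A))
    ◇ₐ-sem {j = j} = mk⇔
      (λ (_ , _ , _ , _ , l , _ , k , k≤l , x) → k , l , k≤l , x)
      -- `j ⊔ l` is to the right of both `j` and `l`. The second `◇ᵣ` moves to the point interval
      -- there, from whose left end `◇ₗ` can go back to `l`.
      (λ (k , l , k≤l , x) → j ⊔ l , ℤ.i≤i⊔j j l , j ⊔ l , ℤ.≤-refl , l , ℤ.i≤j⊔i j l , k , k≤l , x)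

    □ₐ-sem : ∀ {σ : Seq V} {i j} → (σ , i , j ⊨ (□ₐ A)) ⇔ (∀ {k l} → k ≤ l → σ , k , l ⊨ A)
    □ₐ-sem {A} {σ} {i} {j} = mk⇔
      (λ { (inj₁ none) {k} {l} k≤l →
             by-contradiction (λ ¬x → none (from (◇ₐ-sem {~ A} {σ} {i} {j}) (k , l , k≤l , inj₁ ¬x))) })
      (λ all → inj₁ λ x → case to (◇ₐ-sem {~ A} {σ} {i} {j}) x of λ { (k , l , k≤l , inj₁ ¬y) → ¬y (all k≤l) })

    ∧-intro : ∀ {B} {σ : Seq V} {i j} → (σ , i , j ⊨ A) → (σ , i , j ⊨ B) → σ , i , j ⊨ (A ∧ B)
    ∧-intro x y = inj₁ λ { (inj₁ ¬x) → ¬x x ; (inj₂ (inj₁ ¬y)) → ¬y y }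

    ≣-sem : ∀ {B} {σ : Seq V} {i j} → (σ , i , j ⊨ (A ≣ B)) ⇔ ((σ , i , j ⊨ A) ⇔ (σ , i , j ⊨ B))
    ≣-sem {A} {B} {σ} {i} {j} = mk⇔
      (λ { (inj₁ h) → mk⇔
             (λ x → by-contradiction λ ¬y → h (inj₁ λ { (inj₁ ¬x) → ¬x x ; (inj₂ y) → ¬y y }))
             (λ y → by-contradiction λ ¬x → h (inj₂ (inj₁ λ { (inj₁ ¬y) → ¬y y ; (inj₂ x) → ¬x x }))) })
      (λ h → ∧-intro {A ⊃ B} {B ⊃ A} {σ} (implies (to h)) (implies (from h)))
      where
      implies : ∀ {P Q : Set} → (P → Q) → ¬ P ⊎ Q
      implies f = case em of λ { (yes p) → inj₂ (f p) ; (no ¬p) → inj₁ ¬p }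

    rename : (V → V) → Formula V → Formula V
    rename r ff      = ff
    rename r (var q) = var (r q)
    rename r (A ⊃ B) = rename r A ⊃ rename r B
    rename r (○ A)   = ○ rename r A
    rename r (A ⨾ B) = rename r A ⨾ rename r B
    rename r (A ✶)   = rename r A ✶
    rename r (◇ₗ A)  = ◇ₗ rename r A
    rename r (◇ᵣ A)  = ◇ᵣ rename r A

    -- Serves twice: with `replace` as the substitution lemma, and with `id` to show that only the
    -- variables of the formula matter.
    rename-sem : ∀ (r : V → V) {σ τ : Seq V} A → (∀ {v} → v ∈ Var A → ∀ i → σ i v ⇔ τ i (r v)) →
                 ∀ {i j} → (σ , i , j ⊨ A) ⇔ (τ , i , j ⊨ rename r A)
    rename-sem r ff h = mk⇔ id id
    rename-sem r (var q) h {i} = h refl i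
    rename-sem r (A ⊃ B) h =
      let f = rename-sem r A (h ∘ inj₁) ; g = rename-sem r B (h ∘ inj₂) in
      mk⇔ (Sum.map (_∘ from f) (to g)) (Sum.map (_∘ to f) (from g))
    rename-sem r (○ A) h =
      let f = rename-sem r A h in mk⇔ (λ (l , x) → l , to f x) (λ (l , x) → l , from f x)
    rename-sem r {σ} {τ} (A ⨾ B) h = mk⇔
      (λ (k , l , l′ , x , y) → k , l , l′ , to (f {_} {k}) x , to g y)
      (λ (k , l , l′ , x , y) → k , l , l′ , from (f {_} {k}) x , from g y)
      where
      f : ∀ {i j} → (σ , i , j ⊨ A) ⇔ (τ , i , j ⊨ rename r A)
      f = rename-sem r A (h ∘ inj₁)
      g : ∀ {i j} → (σ , i , j ⊨ B) ⇔ (τ , i , j ⊨ rename r B)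
      g = rename-sem r B (h ∘ inj₂)
    rename-sem r {σ} {τ} (A ✶) h = mk⇔
      (from (✶-Star {σ = τ} {rename r A}) ∘ Star.map (λ (l , x) → l , to f x) ∘ to (✶-Star {σ = σ} {A}))
      (from (✶-Star {σ = σ} {A}) ∘ Star.map (λ (l , x) → l , from f x) ∘ to (✶-Star {σ = τ} {rename r A}))
      where
      f : ∀ {i j} → (σ , i , j ⊨ A) ⇔ (τ , i , j ⊨ rename r A)
      f = rename-sem r A h
    rename-sem r (◇ₗ A) h = mk⇔ (λ (k , l , x) → k , l , to (rename-sem r A h) x)
                                (λ (k , l , x) → k , l , from (rename-sem r A h) x)
    rename-sem r (◇ᵣ A) h = mk⇔ (λ (k , l , x) → k , l , to (rename-sem r A h) x)
                                (λ (k , l , x) → k , l , from (rename-sem r A h) x)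

    rename-id : ∀ A → rename id A ≡ A
    rename-id ff      = refl
    rename-id (var q) = refl
    rename-id (A ⊃ B) = cong₂ _⊃_ (rename-id A) (rename-id B)
    rename-id (○ A)   = cong ○_ (rename-id A)
    rename-id (A ⨾ B) = cong₂ _⨾_ (rename-id A) (rename-id B)
    rename-id (A ✶)   = cong _✶ (rename-id A)
    rename-id (◇ₗ A)  = cong ◇ₗ_ (rename-id A)
    rename-id (◇ᵣ A)  = cong ◇ᵣ_ (rename-id A)

    module _ (_≟_ : DecidableEquality V) (q p : V) where

      replace : V → V
      replace v = if does (v ≟ p) then q else v

      substitute-rename : ∀ A → substitute _≟_ (var q) p A ≡ rename replace A
      substitute-rename ff      = refl
      substitute-rename (var v) with does (v ≟ p)
      ... | true  = refl
      ... | false = refl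
      substitute-rename (A ⊃ B) = cong₂ _⊃_ (substitute-rename A) (substitute-rename B)
      substitute-rename (○ A)   = cong ○_ (substitute-rename A)
      substitute-rename (A ⨾ B) = cong₂ _⨾_ (substitute-rename A) (substitute-rename B)
      substitute-rename (A ✶)   = cong _✶ (substitute-rename A)
      substitute-rename (◇ₗ A)  = cong ◇ₗ_ (substitute-rename A)
      substitute-rename (◇ᵣ A)  = cong ◇ᵣ_ (substitute-rename A)

    module _ (_≟_ : DecidableEquality V) where

      override : V → Bool → Pred V 0ℓ → Pred V 0ℓ
      override q b a v = if does (v ≟ q) then T b else a v

      override-here : ∀ q b a → override q b a q ⇔ T b
      override-here q b a with q ≟ q
      ... | yes _  = mk⇔ id id
      ... | no q≢q = contradiction refl q≢q

      override-there : ∀ q b a {v} → v ≢ q → override q b a v ⇔ a v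
      override-there q b a {v} v≢q with v ≟ q
      ... | yes v≡q = contradiction v≡q v≢q
      ... | no _    = mk⇔ id id

  -- Projecting away the variable to be defined.

  module Elimination {V : Set} (_≟_ : DecidableEquality V) (A : Formula V) (p : V) (aut : Aut (~ ◇ₗ ~ A)) where

    open Definability (Var A ∖ ｛ p ｝)
    open Frame
    open Aut

    frm : Frame
    frm = frame aut

    -- A label together with a guessed value of p.
    Guess : Set
    Guess = Label frm × Bool

    Guess-finite : Finite Guess
    Guess-finite = finiteness frm ×-finite Bool-finite

    -- The second factor runs `main` on the one-letter word `l`. Demanded at every point, it makes
    -- `~ ◇ₗ ~ A` true on all point intervals, and this is `A` on all intervals, sorted by their
    -- right ends.
    Node : Guess → Pred V 0ℓ → Set
    Node (l , b) a = Reads frm l (override _≟_ p b a) × acc (main aut) (start (main aut) l)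

    Link : Seq V → (ℤ → Guess) → ℤ → Set
    Link σ g z = Node (g z) (σ z) × edge frm (proj₁ (g z)) (proj₁ (g (sucℤ z)))

    State-of : Side → Set
    State-of d = Guess × State (segment frm d)

    -- A step answers for its source node and the edge out of it; the target node is left to the
    -- next step. Thus only the letter at the left end of a step is read, and consecutive paths fit
    -- together.
    δ : (d : Side) → Pred V 0ℓ → State-of d → State-of d → Set
    δ d a (y , w) (y′ , w′) =
      (Node y a × edge frm (proj₁ y) (proj₁ y′)) × w′ ≡ step (segment frm d) w (proj₁ y′)

    -- Here `p` disappears: the guess `b` turns a literal on `p` into a constant, and all other
    -- literals read variables of `A` different from `p`.
    def-Node : ∀ y → Def (λ σ i _ → Node y (σ i))
    def-Node (l , b) = def-× (go (literals⊆ aut)) (def-const _)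
      where
      literal : ∀ {v} (f : Label frm → Bool) → v ∈ Var A → Def (λ σ i _ → T (f l) ⇔ override _≟_ p b (σ i) v)
      literal {v} f v∈ with v ≟ p
      ... | yes _  = def-const _
      ... | no v≢p = def-⇔ (def-const _) (def-var (v∈ , λ { refl → v≢p refl }))
      go : ∀ {ls} → All (λ (v , _) → v ∈ Var (~ ◇ₗ ~ A)) ls →
           Def (λ σ i _ → All (λ (v , f) → T (f l) ⇔ override _≟_ p b (σ i) v) ls)
      go [] = def-cong (λ _ → mk⇔ (λ _ → []) _) (def-const ⊤)
      go {(_ , f) ∷ _} (inj₁ (inj₁ v∈) ∷ vs) =
        def-cong (λ _ → mk⇔ (λ (x , xs) → x ∷ xs) (λ { (x ∷ xs) → x , xs })) (def-× (literal f v∈) (go vs))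

    def-δ : ∀ d x y → Def (λ σ i _ → δ d (σ i) x y)
    def-δ d (y , w) _ = def-× (def-× (def-Node y) (def-const _)) (def-const _)

    module N d = Limits (Var A ∖ ｛ p ｝) (Guess-finite ×-finite finite (segment frm d)) (δ d) (def-δ d)

    module _ (d : Side) where
      open N d

      -- The segment automaton is total and never blocks a path, so leaving its states free means
      -- plain reachability.
      Reaches : Seq V → ℤ → Guess → ℤ → Guess → Set
      Reaches σ i y j z = ∃[ w ] ∃[ w′ ] Trace σ i (y , w) j (z , w′)

      def-Reaches : ∀ y z → Def (λ σ i j → Reaches σ i y j z)
      def-Reaches y z = def-∃ (finite (segment frm d)) λ w → def-∃ (finite (segment frm d)) λ w′ →
        def-Trace (y , w) (z , w′)

      -- Every interval of colour `e` then admits a path from `y` back to `y` whose labels form an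
      -- accepted segment, and such loops can be strung together along a factorisation into `e`.
      Certifies : Sub → Guess → Set
      Certifies e y = ∃[ w ] acc (segment frm d) w × ((y , start (segment frm d) (proj₁ y)) , (y , w)) ∈ₛ e

    Arrives : (d : Side) → Seq V → ℤ → Guess → ℤ → Guess → Set
    Arrives future σ j y₀ k y = Reaches future σ j y₀ k y
    Arrives past   σ j y₀ k y = Reaches past σ k y j y₀

    -- The automaton, started at j in y₀, has an accepting run on the given side of j.
    Half : Side → Guess → Seq V → ℤ → Set
    Half d y₀ σ j = ∃[ y ] ∃[ e ] Certifies d e y ×
      (∃[ k ] j ≤[ d ] k × j <[ d ] k × Arrives d σ j y₀ k y × N.Lim d d σ e k)

    def-Half-future : ∀ y₀ → Def (λ σ _ j → Half future y₀ σ j)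
    def-Half-future y₀ = def-∃ Guess-finite λ y → def-∃ (N.Sub-finite future) λ e → def-× (def-const _)
      (def-◇ᵣ (def-× def-< (def-× (def-Reaches future y₀ y) (N.def-Lim-future future e))))

    def-Half-past : ∀ y₀ → Def (λ σ i _ → Half past y₀ σ i)
    def-Half-past y₀ = def-∃ Guess-finite λ y → def-∃ (N.Sub-finite past) λ e → def-× (def-const _)
      (def-◇ₗ (def-× def-< (def-× (def-Reaches past y y₀) (N.def-Lim-past past e))))

    Explicit : Seq V → ℤ → ℤ → Set
    Explicit σ i j = ∃[ l ] Half past (l , true) σ i × Half future (l , true) σ i

    abstract
      def-Explicit : Def Explicit
      def-Explicit = def-∃ (finiteness frm) λ l → def-× (def-Half-past (l , true))
        -- `def-Half-future` speaks of the right end of an interval, but variables are read at the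
        -- left end `i`. `◇ₗ` passes to an interval that ends at `i`, for instance the point
        -- interval.
        (def-cong (λ _ → mk⇔ (λ (_ , _ , x) → x) (λ x → _ , ℤ.≤-refl , x)) (def-◇ₗ (def-Half-future (l , true))))

    -- Half-runs and labellings.

    module _ {d : Side} {σ : Seq V} where
      private
        D : DFA (Label frm)
        D = segment frm d

      trace⇒ : ∀ {i y w j y′ w′} → N.Trace d σ i (y , w) j (y′ , w′) →
               ∃[ g ] g i ≡ y × g j ≡ y′ × (∀ z → i ≤ z → z < j → Link σ g z) × Run D (proj₁ ∘ g) i w j w′
      trace⇒ {y = y} [] = (λ _ → y) , refl , refl , (λ z l l′ → contradiction l (ℤ.<⇒≱ l′)) , []
      trace⇒ {i} {y} {j = j} (_∷_ {y = y₁ , _} ((node , e) , refl) r) with trace⇒ r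
      ... | g , gi , gj , links , run = h , at-i , trans (after j (path-≤ r)) gj , links′ , run′
        where
        h : ℤ → Guess
        h z = if does (z ℤ.≟ i) then y else g z
        at-i : h i ≡ y
        at-i with i ℤ.≟ i
        ... | yes _  = refl
        ... | no i≢i = contradiction refl i≢i
        after : ∀ z → sucℤ i ≤ z → h z ≡ g z
        after z le with z ℤ.≟ i
        ... | yes refl = contradiction le (ℤ.<⇒≱ (n<suc[n] i))
        ... | no _     = refl
        h-next : h (sucℤ i) ≡ y₁
        h-next = trans (after _ ℤ.≤-refl) gi
        links′ : ∀ z → i ≤ z → z < j → Link σ h z
        links′ z i≤z z<j with i ℤ.≟ z
        ... | yes refl = subst₂ (λ u v → Node u (σ i) × edge frm (proj₁ u) (proj₁ v)) (sym at-i) (sym h-next) (node , e)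
        ... | no i≢z   = subst₂ (λ u v → Node u (σ z) × edge frm (proj₁ u) (proj₁ v))
          (sym (after z i<z)) (sym (after _ (ℤ.≤-trans i<z (ℤ.i≤suc[i] z)))) (links z i<z z<j)
          where
          i<z : sucℤ i ≤ z
          i<z = ℤ.i<j⇒suc[i]≤j (ℤ.≤∧≢⇒< i≤z i≢z)
        run′ : Run D (proj₁ ∘ h) i _ j _
        run′ = subst (Step (step D) (proj₁ ∘ h) i _) (cong (step D _ ∘ proj₁) h-next) next
          ∷ run-cong D (λ z le _ → cong proj₁ (sym (after z le))) run

      trace⇐ : ∀ {g} → (∀ z → Link σ g z) → ∀ {i w j w′} → Run D (proj₁ ∘ g) i w j w′ →
               N.Trace d σ i (g i , w) j (g j , w′)
      trace⇐ links []         = []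
      trace⇐ links (next ∷ r) = (links _ , refl) ∷ trace⇐ links r

    Between : Side → ℤ → ℤ → ℤ → Set
    Between d i j z = span d (λ i j → i ≤ z × z < j) i j

    between-ends : ∀ d {i j z} → Between d i j z → (i ≤[ d ] z × z ≤[ d ] j) × (i ≤[ d ] sucℤ z × sucℤ z ≤[ d ] j)
    between-ends future (i≤z , z<j) = (i≤z , ℤ.<⇒≤ z<j) , ℤ.≤-trans i≤z (ℤ.i≤suc[i] _) , ℤ.i<j⇒suc[i]≤j z<j
    between-ends past   (j≤z , z<i) = (ℤ.<⇒≤ z<i , j≤z) , ℤ.i<j⇒suc[i]≤j z<i , ℤ.≤-trans j≤z (ℤ.i≤suc[i] _)

    -- `Link` at `z` involves `sucℤ z` too, so the links on the past side of `j` end with the one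
    -- that arrives at `j`. The two sides together cover each link exactly once.
    Beyond : Side → ℤ → ℤ → Set
    Beyond future j z = j ≤ z
    Beyond past   j z = z < j

    locate-between : ∀ d {k : ℕ → ℤ} → (∀ a → k a <[ d ] k (suc a)) → ∀ {z} → Beyond d (k 0) z →
                     ∃[ a ] Between d (k a) (k (suc a)) z
    locate-between future k< b = locate future k< b
    -- Seen towards the past, the near end of the link at `z` is `sucℤ z`, which is therefore the
    -- point to locate.
    locate-between past   k< b with locate past k< (ℤ.i<j⇒suc[i]≤j b)
    ... | a , l , l′ = a , subst (_ ≤_) (ℤ.pred-suc _) (ℤ.i<j⇒i≤pred[j] l′) , ℤ.suc[i]≤j⇒i<j l

    Piece : Side → Seq V → ℤ → ℤ → (ℤ → Guess) → Set
    Piece d σ i j g = ∀ z → Between d i j z → Link σ g z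

    arrives⇒ : ∀ d {σ j y₀ k y} → Arrives d σ j y₀ k y → ∃[ g ] g j ≡ y₀ × g k ≡ y × Piece d σ j k g
    arrives⇒ future (_ , _ , t) = let g , gj , gk , links , _ = trace⇒ t in g , gj , gk , λ z (l , l′) → links z l l′
    arrives⇒ past   (_ , _ , t) = let g , gk , gj , links , _ = trace⇒ t in g , gj , gk , λ z (l , l′) → links z l l′

    certified⇒ : ∀ d {σ e y i j} → Certifies d e y → span d (N.colour d σ) i j ≡ e →
                 ∃[ g ] g i ≡ y × g j ≡ y × Piece d σ i j g × Seg frm d (proj₁ ∘ g) i j
    certified⇒ future {i = i} {j} (w , a , ∈e) refl =
      let g , gi , gj , links , r = trace⇒ (to (N.∈⟦⟧ future) ∈e) in
      g , gi , gj , (λ z (l , l′) → links z l l′) ,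
      w , subst (λ y → Run (segment frm future) (proj₁ ∘ g) i (start (segment frm future) (proj₁ y)) j w) (sym gi) r , a
    certified⇒ past {i = i} {j} (w , a , ∈e) refl =
      let g , gj , gi , links , r = trace⇒ (to (N.∈⟦⟧ past) ∈e) in
      g , gi , gj , (λ z (l , l′) → links z l l′) ,
      w , subst (λ y → Run (segment frm past) (proj₁ ∘ g) j (start (segment frm past) (proj₁ y)) i w) (sym gj) r , a

    Seg-cong : ∀ d {μ ν i j} → (∀ z → i ≤[ d ] z → z ≤[ d ] j → μ z ≡ ν z) → i ≤[ d ] j →
               Seg frm d μ i j → Seg frm d ν i j
    Seg-cong d {μ} {ν} = go d
      where
      transfer : ∀ D {i j} → (∀ z → i ≤ z → z ≤ j → μ z ≡ ν z) → i ≤ j → Accepts D μ i j → Accepts D ν i j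
      transfer D eq i≤j (w , r , a) =
        w , subst (λ l → Run D ν _ (start D l) _ w) (eq _ ℤ.≤-refl i≤j) (run-cong D eq r) , a
      go : ∀ d {i j} → (∀ z → i ≤[ d ] z → z ≤[ d ] j → μ z ≡ ν z) → i ≤[ d ] j → Seg frm d μ i j → Seg frm d ν i j
      go future = transfer (segment frm future)
      go past eq = transfer (segment frm past) (λ z l l′ → eq z l′ l)

    link-cong : ∀ σ g h z → g z ≡ h z → g (sucℤ z) ≡ h (sucℤ z) → Link σ g z → Link σ h z
    link-cong σ g h z eq eq′ = subst₂ (λ u v → Node u (σ z) × edge frm (proj₁ u) (proj₁ v)) eq eq′

    Checkpoints : Side → (ℤ → Label frm) → ℤ → Set
    Checkpoints d ν j = Σ[ k ∈ (ℕ → ℤ) ] j ≤[ d ] k 0 × (∀ a → k a <[ d ] k (suc a) × Seg frm d ν (k a) (k (suc a)))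

    HalfRun : Side → Guess → Seq V → ℤ → (ℤ → Guess) → Set
    HalfRun d y₀ σ j h = h j ≡ y₀ × (∀ z → Beyond d j z → Link σ h z) × Checkpoints d (proj₁ ∘ h) j

    -- `Lim` gives a factorisation into `e` from `k₀`, each factor of which carries the certified
    -- loop at `y`. The path from `y₀` to `y` and all these loops glue together, and the cuts
    -- between the loops are the checkpoints.
    half⇒ : ∀ d {y₀ σ j} → Half d y₀ σ j → ∃ (HalfRun d y₀ σ j)
    half⇒ d {y₀} {σ} {j} (y , e , cert , k₀ , j≤k₀ , j<k₀ , arr , lim) = proj₁ glued , at-j , links ,
        (k ∘ suc) , subst (j ≤[ d ]_) (sym f0) j≤k₀ , λ a → k< (suc a) ,
        Seg-cong d (λ z l l′ → cong proj₁ (sym (proj₂ glued (suc a) z l l′))) (<[]⇒≤[] d (k< (suc a)))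
          (proj₂ (proj₂ (proj₂ (proj₂ (loop a)))))
      where
      fact : N.Factorises d d σ e k₀
      fact = N.Lim⇒Factorises d d σ (N.colour-extend d d) lim
      f : ℕ → ℤ
      f = proj₁ fact
      f0 : f 0 ≡ k₀
      f0 = proj₁ (proj₂ fact)
      -- The points of the factorisation are shifted by one to make room for `j`; glueing needs a
      -- strictly monotone sequence, hence the strict `j<k₀`.
      k : ℕ → ℤ
      k zero    = j
      k (suc a) = f a
      k< : ∀ a → k a <[ d ] k (suc a)
      k< zero    = subst (j <[ d ]_) (sym f0) j<k₀
      k< (suc a) = proj₁ (proj₂ (proj₂ fact) a)
      first : ∃[ g ] g j ≡ y₀ × g (f 0) ≡ y × Piece d σ j (f 0) g
      first = subst (λ z → ∃[ g ] g j ≡ y₀ × g z ≡ y × Piece d σ j z g) (sym f0) (arrives⇒ d arr)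
      loop : ∀ a → ∃[ g ] g (f a) ≡ y × g (f (suc a)) ≡ y × Piece d σ (f a) (f (suc a)) g ×
             Seg frm d (proj₁ ∘ g) (f a) (f (suc a))
      loop a = certified⇒ d cert (proj₂ (proj₂ (proj₂ fact) a))
      g : ℕ → ℤ → Guess
      g zero    = proj₁ first
      g (suc a) = proj₁ (loop a)
      joint : ∀ a → g a (k (suc a)) ≡ g (suc a) (k (suc a))
      joint zero    = trans (proj₁ (proj₂ (proj₂ first))) (sym (proj₁ (proj₂ (loop 0))))
      joint (suc a) = trans (proj₁ (proj₂ (proj₂ (loop a)))) (sym (proj₁ (proj₂ (loop (suc a)))))
      pieces : ∀ a → Piece d σ (k a) (k (suc a)) (g a)
      pieces zero    = proj₂ (proj₂ (proj₂ first))
      pieces (suc a) = proj₁ (proj₂ (proj₂ (proj₂ (loop a))))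
      glued : ∃[ h ] (∀ a z → k a ≤[ d ] z → z ≤[ d ] k (suc a) → h z ≡ g a z)
      glued = glue d k< g joint
      at-j : proj₁ glued j ≡ y₀
      at-j = trans (proj₂ glued 0 j (≤[]-refl d) (<[]⇒≤[] d (k< 0))) (proj₁ (proj₂ first))
      links : ∀ z → Beyond d j z → Link σ (proj₁ glued) z
      links z b with locate-between d k< b
      ... | a , btw with between-ends d btw
      ... | (l₁ , l₂) , (l₃ , l₄) =
        link-cong σ (g a) (proj₁ glued) z (sym (proj₂ glued a z l₁ l₂))
          (sym (proj₂ glued a (sucℤ z) l₃ l₄)) (pieces a z btw)

    FullRun : Seq V → (ℤ → Guess) → Set
    FullRun σ y = (∀ z → Link σ y z) ×
      (∀ d → Σ[ k ∈ (ℕ → ℤ) ] (∀ a → k a <[ d ] k (suc a) × Seg frm d (proj₁ ∘ y) (k a) (k (suc a))))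

    join : ∀ {y₀ σ j g h} → HalfRun past y₀ σ j g → HalfRun future y₀ σ j h → ∃[ y ] y j ≡ y₀ × FullRun σ y
    join {y₀} {σ} {j} {g} {h} (gj , g-links , k , k≤j , g-segs) (hj , h-links , k′ , j≤k′ , h-segs) =
        y , trans (right j ℤ.≤-refl) hj , links , segs
      where
      y : ℤ → Guess
      y z = if does (j ℤ.≤? z) then h z else g z
      right : ∀ z → j ≤ z → y z ≡ h z
      right z j≤z with j ℤ.≤? z
      ... | yes _   = refl
      ... | no ¬j≤z = contradiction j≤z ¬j≤z
      left : ∀ z → z ≤ j → y z ≡ g z
      left z z≤j with j ℤ.≤? z
      ... | no _    = refl
      ... | yes j≤z with ℤ.≤-antisym z≤j j≤z
      ... | refl = trans hj (sym gj)
      links : ∀ z → Link σ y z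
      links z = case j ℤ.≤? z of λ where
        (yes j≤z) → link-cong σ h y z (sym (right z j≤z)) (sym (right _ (ℤ.≤-trans j≤z (ℤ.i≤suc[i] z)))) (h-links z j≤z)
        (no ¬j≤z) → let z<j = ℤ.≰⇒> ¬j≤z in
          link-cong σ g y z (sym (left z (ℤ.<⇒≤ z<j))) (sym (left _ (ℤ.i<j⇒suc[i]≤j z<j))) (g-links z z<j)
      segs : ∀ d → Σ[ k ∈ (ℕ → ℤ) ] (∀ a → k a <[ d ] k (suc a) × Seg frm d (proj₁ ∘ y) (k a) (k (suc a)))
      segs future = k′ , λ a → proj₁ (h-segs a) , Seg-cong future
        (λ z l _ → cong proj₁ (sym (right z (ℤ.≤-trans j≤k′ (ℤ.≤-trans (increasing future (proj₁ ∘ h-segs) ℕ.z≤n) l)))))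
        (ℤ.<⇒≤ (proj₁ (h-segs a))) (proj₂ (h-segs a))
      segs past = k , λ a → proj₁ (g-segs a) , Seg-cong past
        (λ z l _ → cong proj₁ (sym (left z (ℤ.≤-trans l (ℤ.≤-trans (increasing past (proj₁ ∘ g-segs) ℕ.z≤n) k≤j)))))
        (ℤ.<⇒≤ (proj₁ (g-segs a))) (proj₂ (g-segs a))

    halves⇒ : ∀ {y₀ σ j} → Half past y₀ σ j → Half future y₀ σ j → ∃[ y ] y j ≡ y₀ × FullRun σ y
    halves⇒ hp hf = join (proj₂ (half⇒ past hp)) (proj₂ (half⇒ future hf))

    -- A recurring guess `x` is fixed first, and then `k` and `e` are picked among its occurrences.
    -- Only afterwards must a segment from `k` be accepted, which the strong condition grants for
    -- every end beyond some bound.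
    half⇐ : ∀ d {σ y} → (∀ z → Link σ y z) → (∀ k → ∃[ K ] (∀ k′ → K ≤[ d ] k′ → Seg frm d (proj₁ ∘ y) k k′)) →
            ∀ j → Half d (y j) σ j
    half⇐ d {σ} {y} links segs j = from-limit (proj₂ recurrent)
      where
      recurrent : ∃[ x ] Infinite d (λ n → y n ≡ x × j <[ d ] n)
      recurrent = infinite-pigeonhole d Guess-finite λ m →
        let m′ , m≤ , j≤ = upper-bound d m j ; n , m′<n = beyond d m′ in
        n , ≤[]-<[]-trans d m≤ m′<n , y n , refl , ≤[]-<[]-trans d j≤ m′<n
      arrives : ∀ d {j k} → j ≤[ d ] k → Arrives d σ j (y j) k (y k)
      arrives future {j} j≤k =
        let w , r = run-total (segment frm future) (start (segment frm future) (proj₁ (y j))) j≤k in _ , w , trace⇐ links r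
      arrives past {k = k} k≤j =
        let w , r = run-total (segment frm past) (start (segment frm past) (proj₁ (y k))) k≤j in _ , w , trace⇐ links r
      certify : ∀ d {i j} → y i ≡ y j → Seg frm d (proj₁ ∘ y) i j → Certifies d (span d (N.colour d σ) i j) (y i)
      certify future {i} {j} eq (w , r , a) = w , a , from (N.∈⟦⟧ future)
        (subst (λ u → N.Trace future σ i (y i , start (segment frm future) (proj₁ (y i))) j (u , w)) (sym eq)
          (trace⇐ links r))
      certify past {i} {j} eq (w , r , a) = w , a , from (N.∈⟦⟧ past)
        (subst (λ u → N.Trace past σ j (u , start (segment frm past) (proj₁ u)) i (y i , w)) (sym eq) (trace⇐ links r))
      from-limit : ∀ {x} → Infinite d (λ n → y n ≡ x × j <[ d ] n) → Half d (y j) σ j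
      from-limit {x} inf = x , e , certifies , k , <[]⇒≤[] d j<k , j<k ,
          subst (Arrives d σ j (y j) k) yk (arrives d (<[]⇒≤[] d j<k)) ,
          λ m _ → let n , lt , _ , _ , e≡ , merge = inf′ m in n , lt , e≡ , merge
        where
        point : ∃[ k ] ∃[ e ] (y k ≡ x × j <[ d ] k) ×
                Infinite d (λ n → k ≤[ d ] n × (y n ≡ x × j <[ d ] n) ×
                  span d (N.colour d σ) k n ≡ e × N.Merge d d σ k n)
        point = N.limit-point d d σ (N.Sub-finite d) inf
        k : ℤ
        k = proj₁ point
        e : N.Sub d
        e = proj₁ (proj₂ point)
        yk : y k ≡ x
        yk = proj₁ (proj₁ (proj₂ (proj₂ point)))
        j<k : j <[ d ] k
        j<k = proj₂ (proj₁ (proj₂ (proj₂ point)))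
        inf′ : Infinite d (λ n → k ≤[ d ] n × (y n ≡ x × j <[ d ] n) ×
                 span d (N.colour d σ) k n ≡ e × N.Merge d d σ k n)
        inf′ = proj₂ (proj₂ (proj₂ point))
        certifies : Certifies d e x
        -- A single return to `x` beyond `K` is enough, because it places the certificate in the
        -- colour `e` itself.
        certifies = let K , s = segs k ; n , K<n , _ , (yn , _) , e≡ , _ = inf′ K in
          subst₂ (Certifies d) e≡ yk (certify d (trans yk (sym yn)) (s n (<[]⇒≤[] d K<n)))

    completion : Seq V → (ℤ → Guess) → Seq V
    completion σ y z = override _≟_ p (proj₂ (y z)) (σ z)

    fullRun⇒ : ∀ {σ y} → FullRun σ y → ∀ {i j} → i ≤ j → completion σ y , i , j ⊨ A
    fullRun⇒ {σ} {y} (links , segs) {i} {j} i≤j =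
      unpack (to (sound aut weak ℤ.≤-refl) (_ , [] , proj₂ (proj₁ (links j))))
      where
      weak : Weak frm (completion σ y) (proj₁ ∘ y)
      weak = (λ z → proj₁ (proj₁ (links z)) , proj₂ (links z)) , segs
      unpack : completion σ y , j , j ⊨ (~ ◇ₗ ~ A) → completion σ y , i , j ⊨ A
      unpack (inj₁ none) = by-contradiction λ ¬x → none (i , i≤j , inj₁ ¬x)

    checkpoints : ∀ d {ν} → (∀ k → ∃[ K ] (∀ k′ → K ≤[ d ] k′ → Seg frm d ν k k′)) →
                  Σ[ k ∈ (ℕ → ℤ) ] (∀ a → k a <[ d ] k (suc a) × Seg frm d ν (k a) (k (suc a)))
    checkpoints d {ν} segs = k , λ a → proj₂ (after (k a))
      where
      after : ∀ k → ∃[ k′ ] k <[ d ] k′ × Seg frm d ν k k′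
      after k = let K , s = segs k ; M , k≤M , K≤M = upper-bound d k K ; n , M<n = beyond d M in
        n , ≤[]-<[]-trans d k≤M M<n , s n (≤[]-trans d K≤M (<[]⇒≤[] d M<n))
      k : ℕ → ℤ
      k zero    = + 0
      k (suc a) = proj₁ (after (k a))

    -- The run labels `σ` itself and guesses the true values of `p`, so that its completion is `σ`
    -- again.
    ⇒halves : ∀ {σ : Seq V} → (∀ {k l} → k ≤ l → σ , k , l ⊨ A) →
              ∀ j {b} → T b ⇔ σ j p → ∃[ l ] Half past (l , b) σ j × Half future (l , b) σ j
    ⇒halves {σ} models j {b} b⇔ = ν j , half past , half future
      where
      ν : ℤ → Label frm
      ν = proj₁ (inhabited aut σ)
      local : Local frm σ ν
      local = proj₁ (proj₂ (inhabited aut σ))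
      segs : ∀ d k → ∃[ K ] (∀ k′ → K ≤[ d ] k′ → Seg frm d ν k k′)
      segs = proj₂ (proj₂ (inhabited aut σ))
      y : ℤ → Guess
      y z = ν z , does (em {σ z p})
      same : ∀ z v → σ z v ⇔ completion σ y z v
      same z v with v ≟ p
      ... | yes refl = mk⇔ (from (T-does em)) (to (T-does em))
      ... | no _     = mk⇔ id id
      weak : Weak frm σ ν
      weak = local , λ d → checkpoints d (segs d)
      links : ∀ z → Link σ y z
      links z = ( All.map (λ {(v , _)} h → mk⇔ (to (same z v) ∘ to h) (from h ∘ from (same z v))) (proj₁ (local z))
                , to (accepts⇔ (main aut) [])
                    (from (sound aut weak ℤ.≤-refl) (inj₁ λ { (_ , l , inj₁ ¬x) → ¬x (models l) })) )
              , proj₂ (local z)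
      y≡ : y j ≡ (ν j , b)
      y≡ = cong (ν j ,_) (does-⇔ (mk⇔ (from b⇔) (to b⇔)) em (T? b))
      half : ∀ d → Half d (ν j , b) σ j
      half d = subst (λ u → Half d u σ j) y≡ (half⇐ d links (segs d) j)

  -- Uniqueness of the guess and the explicit definition.

  module _ {V : Set} (_≟_ : DecidableEquality V) (A : Formula V) (p p′ : V) (p′≢p : p′ ≢ p) (p′∉A : p′ ∉ Var A)
           (implicit : ⊨ ((□ₐ A ∧ □ₐ (substitute _≟_ (var p′) p A)) ⊃ □ₐ (var p ≣ var p′))) where

    -- `τ` stores the rival values `b` under `p′`. Freshness keeps `A` true in `τ`, and the renamed
    -- copy holds because it reads at `p′` what the rival model has at `p`; the hypothesis then
    -- equates the two.
    implicit⇒unique : ∀ {σ : Seq V} {b : ℤ → Bool} → (∀ {i j} → i ≤ j → σ , i , j ⊨ A) →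
                      (∀ {i j} → i ≤ j → (λ z → override _≟_ p (b z) (σ z)) , i , j ⊨ A) →
                      ∀ i → σ i p ⇔ T (b i)
    implicit⇒unique {σ} {b} models models′ i = mk⇔
      (to (override-here _≟_ p′ (b i) (σ i)) ∘ to p⇔p′ ∘ from (override-there _≟_ p′ (b i) (σ i) (p′≢p ∘ sym)))
      (to (override-there _≟_ p′ (b i) (σ i) (p′≢p ∘ sym)) ∘ from p⇔p′ ∘ from (override-here _≟_ p′ (b i) (σ i)))
      where
      τ : Seq V
      τ z = override _≟_ p′ (b z) (σ z)
      unchanged : ∀ {v} → v ∈ Var A → ∀ z → σ z v ⇔ τ z v
      unchanged {v} v∈ z = mk⇔ (from h) (to h)
        where
        h : τ z v ⇔ σ z v
        h = override-there _≟_ p′ (b z) (σ z) λ { refl → p′∉A v∈ }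
      renamed : ∀ {v} → v ∈ Var A → ∀ z → override _≟_ p (b z) (σ z) v ⇔ τ z (replace _≟_ p′ p v)
      renamed {v} v∈ z with v ≟ p
      ... | yes _ = mk⇔ (from (override-here _≟_ p′ (b z) (σ z))) (to (override-here _≟_ p′ (b z) (σ z)))
      ... | no _  = unchanged v∈ z
      τ-A : ∀ {i j} → i ≤ j → τ , i , j ⊨ A
      τ-A {i} {j} i≤j = subst (λ B → τ , i , j ⊨ B) (rename-id A) (to (rename-sem id {σ} {τ} A unchanged) (models i≤j))
      τ-A′ : ∀ {i j} → i ≤ j → τ , i , j ⊨ substitute _≟_ (var p′) p A
      τ-A′ {i} {j} i≤j = subst (λ B → τ , i , j ⊨ B) (sym (substitute-rename _≟_ p′ p A))
        (to (rename-sem (replace _≟_ p′ p) {_} {τ} A renamed) (models′ i≤j))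
      p⇔p′ : τ i p ⇔ τ i p′
      p⇔p′ with implicit τ i i ℤ.≤-refl
      ... | inj₂ h = to (≣-sem {A = var p} {B = var p′} {τ} {i} {i})
        (to (□ₐ-sem {A = var p ≣ var p′} {τ} {i} {i}) h ℤ.≤-refl)
      ... | inj₁ h = contradiction
        (∧-intro {A = □ₐ A} {B = □ₐ (substitute _≟_ (var p′) p A)} {τ} {i} {i}
          (from (□ₐ-sem {A = A} {τ} {i} {i}) τ-A)
          (from (□ₐ-sem {A = substitute _≟_ (var p′) p A} {τ} {i} {i}) τ-A′)) h

    open Elimination _≟_ A p (automaton (~ ◇ₗ ~ A))
    open Definability (Var A ∖ ｛ p ｝) using (module Def)

    -- From right to left, the half-runs join to a run that completes `σ` to a model of `A` with `p`
    -- true at `i`, and uniqueness hands this value back to `σ`.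
    explicit : ∀ {σ : Seq V} → (∀ {i j} → i ≤ j → σ , i , j ⊨ A) → ∀ i → σ i p ⇔ Explicit σ i i
    explicit {σ} models i = mk⇔
      (λ x → ⇒halves models i (mk⇔ (λ _ → x) _))
      (λ (l , hp , hf) → let y , yi , run = halves⇒ hp hf in
        from (implicit⇒unique models (fullRun⇒ run) i) (subst (T ∘ proj₂) (sym yi) tt))

    definition : Formula V
    definition = Def.formula def-Explicit

    definition-vars : Var definition ⊆ Var A ∖ ｛ p ｝
    definition-vars = Def.vars def-Explicit

    definition-valid : ⊨ (□ₐ A ⊃ □ₐ (var p ≣ definition))
    definition-valid σ i j i≤j with em {σ , i , j ⊨ (□ₐ A)}
    ... | no ¬h = inj₁ ¬h
    ... | yes h = inj₂ (from (□ₐ-sem {A = var p ≣ definition} {σ} {i} {j}) λ {k} {l} k≤l →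
      let e = explicit (to (□ₐ-sem {A = A} {σ} {i} {j}) h) k ; d = Def.sem def-Explicit k≤l in
      from (≣-sem {A = var p} {B = definition} {σ} {k} {l}) (mk⇔ (from d ∘ to e) (from e ∘ to d)))

corollary20 : ExcludedMiddle 0ℓ →
    {V : Set} (_≟_ : DecidableEquality V)
    (A : Formula V) (p p′ : V) → p′ ≢ p → p′ ∉ Var A →
    ⊨ ((□ₐ A ∧ □ₐ (substitute _≟_ (var p′) p A)) ⊃ □ₐ (var p ≣ var p′)) →
    ∃[ C ] (Var C ⊆ Var A ∖ ｛ p ｝) × (⊨ (□ₐ A ⊃ □ₐ (var p ≣ C)))
corollary20 em _≟_ A p p′ p′≢p p′∉A implicit =
  definition em _≟_ A p p′ p′≢p p′∉A implicit ,
  definition-vars em _≟_ A p p′ p′≢p p′∉A implicit ,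
  definition-valid em _≟_ A p p′ p′≢p p′∉A implicit
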